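{- Let $\mathbf r,\mathbf c\in\mathbb Z_{>0}^3$ with $r_1+r_2+r_3=c_1+c_2+c_3$, and let $\operatorname{T}_{\mathbf r\mathbf c}$ be the corresponding $3\times3$ transportation polytope. If $\operatorname{T}_{\mathbf r\mathbf c}$ is not a multiple of the Birkhoff polytope $B_3$ (i.e. it is not the case that $\mathbf r=\mathbf c=(k,k,k)$ for some positive integer $k$), then the toric ideal $I_{\operatorname{T}_{\mathbf r\mathbf c}}$ has a squarefree quadratic initial ideal, i.e. there is a term order for which the initial ideal of $I_{\operatorname{T}_{\mathbf r\mathbf c}}$ is generated by squarefree monomials of degree $2$.
   Context: The $3\times3$ transportation polytope $\operatorname{T}_{\mathbf r\mathbf c}\subset\mathbb R^{9}$ is the set of all real nonnegative $3\times3$ matrices with row sums $r_1,r_2,r_3$ and column sums $c_1,c_2,c_3$; $B_3=\operatorname{T}_{(1,1,1),(1,1,1)}$, so $kB_3=\operatorname{T}_{(k,k,k),(k,k,k)}$. For a lattice polytope $P\subset\mathbb R^d$ with lattice points $P\cap\mathbb Z^d=\{\mathbf a_1,\ldots,\mathbf a_r\}$, the toric ideal $I_P$ is the kernel of the ring homomorphism $\mathbb k[x_1,\ldots,x_r]\to\mathbb k[t_0^{\pm1},\ldots,t_d^{\pm1}]$, $x_i\mapsto t_0\,t_1^{a_{1i}}\cdots t_d^{a_{di}}$ ($\mathbb k$ a field). -}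

module Defs where

open import Level using (Level; _⊔_) renaming (suc to lsuc; zero to lzero)
open import Algebra.Bundles using (CommutativeRing)
open import Data.Nat as ℕ using (ℕ; zero; suc; _≤_)
import Data.Nat.Properties as ℕP
open import Data.Fin using (Fin)
open import Data.Vec as V using (Vec; []; _∷_)
import Data.Vec.Properties as VP
open import Data.List as L using (List; []; _∷_; filter; length)
open import Data.List.Relation.Unary.All using (All)
import Data.Vec.Relation.Unary.All as VAll
open import Data.Product using (Σ; ∃; _×_; _,_; proj₁; proj₂)
open import Data.Product.Properties using (≡-dec)
open import Relation.Nullary using (¬_; Dec; yes; no; _×-dec_)
open import Relation.Binary using (DecidableEquality; IsStrictTotalOrder)
open import Relation.Binary.PropositionalEquality using (_≡_; _≢_)

record Field (c ℓ : Level) : Set (lsuc (c ⊔ ℓ)) where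
  field
    commutativeRing : CommutativeRing c ℓ
  open CommutativeRing commutativeRing public
  field
    1≉0     : ¬ (1# ≈ 0#)
    inverse : ∀ x → ¬ (x ≈ 0#) → Σ Carrier λ y → (x * y) ≈ 1#

Mat : Set
Mat = Vec (Vec ℕ 3) 3

_≟M_ : DecidableEquality Mat
_≟M_ = VP.≡-dec (VP.≡-dec ℕP._≟_)

rowSums : Mat → Vec ℕ 3
rowSums M = V.map V.sum M

colSums : Mat → Vec ℕ 3
colSums M = V.map V.sum (V.transpose M)

_+M_ : Mat → Mat → Mat
M +M N = V.zipWith (V.zipWith ℕ._+_) M N

_·M_ : ℕ → Mat → Mat
k ·M M = V.map (V.map (k ℕ.*_)) M

0M : Mat
0M = V.replicate 3 (V.replicate 3 0)

allVecs : (N k : ℕ) → List (Vec ℕ k)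
allVecs N zero    = [] ∷ []
allVecs N (suc k) =
  L.concatMap (λ x → L.map (x ∷_) (allVecs N k)) (L.upTo (suc N))

allMats : ℕ → List Mat
allMats N = L.concatMap (λ a → L.concatMap (λ b → L.map (λ c → a ∷ b ∷ c ∷ [])
                (allVecs N 3)) (allVecs N 3)) (allVecs N 3)

-- The lattice points of the transportation polytope T_rc, i.e. all
-- nonnegative integer 3×3 matrices with row sums r and column sums c,
-- listed as a_1, …, a_n (every entry is bounded by r₁+r₂+r₃).
latticePoints : Vec ℕ 3 → Vec ℕ 3 → List Mat
latticePoints r c =
  filter (λ M → (VP.≡-dec ℕP._≟_ (rowSums M) r) ×-dec (VP.≡-dec ℕP._≟_ (colSums M) c))
         (allMats (V.sum r))

nPts : Vec ℕ 3 → Vec ℕ 3 → ℕ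
nPts r c = length (latticePoints r c)

pt : (r c : Vec ℕ 3) → Fin (nPts r c) → Mat
pt r c i = L.lookup (latticePoints r c) i

-- Finitely supported K-linear combinations of "exponents" e ∈ E,
-- represented by lists of terms; equality is via coefficients.

module Poly {c ℓ : Level} (F : Field c ℓ) where
  open Field F

  Lin : Set → Set c
  Lin E = List (Carrier × E)

  coeff : {E : Set} → DecidableEquality E → Lin E → E → Carrier
  coeff _≟_ []             e = 0#
  coeff _≟_ ((a , e′) ∷ p) e with e′ ≟ e
  ... | yes _ = a + coeff _≟_ p e
  ... | no  _ = coeff _≟_ p e

  Mono : ℕ → Set
  Mono n = Vec ℕ n

  _≟m_ : ∀ {n} → DecidableEquality (Mono n)
  _≟m_ = VP.≡-dec ℕP._≟_

  Pol : ℕ → Set c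
  Pol n = Lin (Mono n)

  coeffP : ∀ {n} → Pol n → Mono n → Carrier
  coeffP = coeff _≟m_

  _≈P_ : ∀ {n} → Pol n → Pol n → Set ℓ
  p ≈P q = ∀ m → coeffP p m ≈ coeffP q m

  monoMul : ∀ {n} → Mono n → Mono n → Mono n
  monoMul = V.zipWith ℕ._+_

  _*P_ : ∀ {n} → Pol n → Pol n → Pol n
  p *P q = L.concatMap (λ { (a , u) → L.map (λ { (b , v) → (a * b , monoMul u v) }) q }) p

  _+P_ : ∀ {n} → Pol n → Pol n → Pol n
  _+P_ = L._++_

  0P : ∀ {n} → Pol n
  0P = []

  monoP : ∀ {n} → Mono n → Pol n
  monoP m = (1# , m) ∷ []

  _∈⟨_⟩ : ∀ {n} {s} → Pol n → (Pol n → Set s) → Set (c ⊔ ℓ ⊔ s)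
  _∈⟨_⟩ {n} p S = Σ (List (Pol n × Pol n)) λ hs →
               All (λ hg → S (proj₂ hg)) hs ×
               (p ≈P L.foldr (λ hg acc → (proj₁ hg *P proj₂ hg) +P acc) 0P hs)

  -- Toric ideal of T_rc: kernel of x_i ↦ t_0 t^{a_i}.  All a_i ≥ 0, so
  -- the image lies in the subring k[t_0,…,t_9] of the Laurent ring;
  -- target monomials t_0^d t^B are encoded as pairs (d , B) ∈ ℕ × Mat.

  TExp : Set
  TExp = ℕ × Mat

  _≟T_ : DecidableEquality TExp
  _≟T_ = ≡-dec ℕP._≟_ _≟M_

  module Toric (r c′ : Vec ℕ 3) where
    n : ℕ
    n = nPts r c′

    imgMono : Mono n → TExp
    imgMono u = V.sum u , V.foldr _ _+M_ 0M (V.zipWith _·M_ u (V.tabulate (pt r c′)))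

    φ : Pol n → Lin TExp
    φ p = L.map (λ { (a , u) → (a , imgMono u) }) p

    InToric : Pol n → Set ℓ
    InToric p = ∀ e → coeff _≟T_ (φ p) e ≈ 0#

  record TermOrder (n : ℕ) : Set₁ where
    field
      _≺_      : Mono n → Mono n → Set
      isSTO    : IsStrictTotalOrder _≡_ _≺_
      mult     : ∀ u v w → u ≺ v → monoMul u w ≺ monoMul v w
      oneLeast : ∀ u → u ≢ V.replicate n 0 → V.replicate n 0 ≺ u

  IsInitMono : ∀ {n} → TermOrder n → Pol n → Mono n → Set ℓ
  IsInitMono {n} T f m =
    ¬ (coeffP f m ≈ 0#) × (∀ m′ → m ≺ m′ → coeffP f m′ ≈ 0#)
    where open TermOrder T

  InitGen : ∀ {n} {s} → TermOrder n → (Pol n → Set s) → Pol n → Set (c ⊔ ℓ ⊔ s)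
  InitGen {n} T I g = Σ (Pol n) λ f → Σ (Mono n) λ m →
                        I f × IsInitMono T f m × (g ≡ monoP m)

  SquarefreeQuadratic : ∀ {n} → Mono n → Set
  SquarefreeQuadratic u = (V.sum u ≡ 2) × VAll.All (_≤ 1) u

{-# OPTIONS --safe #-}

-- The term order compares monomials by a weight, then lexicographically.  The weight of a
-- lattice point m is 5 Σ m_ij² + m_13² + m_23² + 3 (m_11 + m_22)², where Σ omits the entries
-- 13 and 23 and the rows and columns are permuted so that r_3 < c_3 (which is possible unless
-- all r_i and c_j coincide).  The candidate initial ideal is generated by the products x_a x_b
-- (a ≠ b) that are not minimal in their fibre; the point is that two monomials u, v in the same
-- fibre, both divisible by no such product, are equal.
--
-- Rounding the average of two points shows that within u the entries of each of the first two
-- columns differ by at most one.  Hence each of these columns takes at most three values, and u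
-- is a 3×3 table of multiplicities whose margins are determined by the fibre.  If the tables of
-- u and v differ, they differ along a 4-cycle or a 6-cycle.  A 4-cycle consists of two distinct
-- minimal products in the same fibre, which is impossible.  In a 6-cycle, a finite check finds
-- two points on one side that can be improved by swapping their second columns; the swap yields
-- nonnegative entries because m_13 + m_23 ≥ c_3 - r_3 > 0.
module Submission where

open import Defs
open import Level using (Level)
open import Data.Bool using (Bool; true; false; if_then_else_; not)
open import Data.Empty using (⊥)
open import Data.Fin using (Fin; zero; suc)
open import Data.Fin.Patterns using (0F; 1F; 2F)
import Data.Fin.Base as Fin using (combine; remQuot)
import Data.Fin.Properties as Fin
open import Data.Fin.Subset.Properties using (anySubset?)
open import Data.List as List using (List; []; _∷_; map; filter; cartesianProduct; allFin; concatMap; length; foldr)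
open import Data.List.Membership.Propositional using (_∈_; find; lose)
open import Data.List.Membership.Propositional.Properties using (∈-map⁻; ∈-map⁺; ∈-filter⁻; ∈-filter⁺; ∈-cartesianProduct⁺; ∈-allFin; ∈-concatMap⁺; ∈-concatMap⁻; ∈-upTo⁺; ∈-lookup)
open import Data.List.Relation.Unary.All as All using (All; []; _∷_)
open import Data.List.Relation.Unary.Any as Any using (here; there)
open import Data.List.Relation.Unary.Any.Properties using (lookup-index)
open import Data.List.Relation.Unary.Unique.Propositional using (Unique; []; _∷_)
import Data.List.Relation.Unary.Unique.Propositional.Properties as Unique
open import Data.Nat
open import Data.Nat.Divisibility using (_∣_; _∣?_; ∣m+n∣m⇒∣n; m∣m*n)
open import Data.Nat.DivMod using (m/n*n≤m; m≡m%n+[m/n]*n; m%n<n)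
open import Data.Nat.Induction using (<-wellFounded)
open import Data.Nat.Properties
open import Data.Nat.Tactic.RingSolver using (solve-∀)
open import Data.Product using (Σ; ∃; _×_; _,_; proj₁; proj₂; map₂)
open import Data.Sum using (_⊎_; inj₁; inj₂)
open import Data.Vec as Vec using (Vec; []; _∷_; lookup; sum)
open import Data.Vec.Properties using (≡-dec; lookup-map; lookup-replicate; lookup-zipWith; zipWith-comm; zipWith-assoc; zipWith-identityˡ; lookup∘tabulate; tabulate∘lookup; tabulate-cong; ∷-injective)
import Data.Vec.Relation.Binary.Lex.Strict as Lex
import Data.Vec.Relation.Binary.Pointwise.Inductive as Pointwise
open import Data.Vec.Relation.Unary.All using ([]; _∷_) renaming (All to VAll)
import Data.Vec.Relation.Unary.All.Properties as VAll
open import Function using (_∘_; _on_; case_of_)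
open import Induction.WellFounded using (WellFounded; Acc; acc)
open import Relation.Binary using (Tri; tri<; tri≈; tri>; IsStrictTotalOrder; IsEquivalence; DecidableEquality)
import Relation.Binary.Construct.On as On
open import Relation.Binary.PropositionalEquality
open import Relation.Nullary using (¬_; Dec; does; yes; no; contradiction)
open import Relation.Nullary.Decidable using (_×-dec_; _⊎-dec_; _→-dec_; ¬?; from-yes; from-no; decidable-stable)

-- The obstacle is visible in `B_3`: its six permutation matrices form a 6-cycle, and the resulting
-- cubic relation is not generated by quadrics. In the analogous 6-cycle, where every point raises
-- different rows in its first two columns, the last column of each point loses one unit in each of
-- two rows. Swapping second columns makes one point lose two units in a single row. This needs a
-- spare unit there, which `r_3 < c_3` supplies in row 1 or row 2, and it increases a plain sum of
-- squares. The diagonal term is there to reverse that: on one of the two sides, the swap that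
-- concentrates the loss in row 1 or row 2 saves 3 · 2² = 12 in the squared differences. The same
-- swap costs 4 when the entries 13 and 23 have coefficient 1, but would cost 20 with coefficient 5;
-- this is why these two entries are set apart.

-- Exponent vectors and totals of a function over the factors of a monomial

dot : ∀ {n} → Vec ℕ n → (Fin n → ℕ) → ℕ
dot []      f = 0
dot (x ∷ u) f = x * f zero + dot u (f ∘ suc)

private
  interchange : ∀ a b c d → a + b + (c + d) ≡ a + c + (b + d)
  interchange = solve-∀

dot-+ : ∀ {n} (u : Vec ℕ n) f g → dot u (λ k → f k + g k) ≡ dot u f + dot u g
dot-+ []      f g = refl
dot-+ (x ∷ u) f g = trans
  (cong₂ _+_ (*-distribˡ-+ x (f zero) (g zero)) (dot-+ u (f ∘ suc) (g ∘ suc)))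
  (interchange (x * f zero) (x * g zero) (dot u (f ∘ suc)) (dot u (g ∘ suc)))

dot-const : ∀ {n} (u : Vec ℕ n) c → dot u (λ _ → c) ≡ sum u * c
dot-const []      c = refl
dot-const (x ∷ u) c = trans (cong (x * c +_) (dot-const u c)) (sym (*-distribʳ-+ c x (sum u)))

-- The comparison is asked only where `u` is positive, because the bounds on entries are known only
-- for the points that divide a standard monomial.
dot-mono : ∀ {n} (u : Vec ℕ n) {f g} →
  (∀ k → 1 ≤ lookup u k → f k ≤ g k) → dot u f ≤ dot u g
dot-mono []          h = z≤n
dot-mono (zero  ∷ u) h = dot-mono u (h ∘ suc)
dot-mono (suc x ∷ u) h = +-mono-≤ (*-monoʳ-≤ (suc x) (h zero (s≤s z≤n))) (dot-mono u (h ∘ suc))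

dot-mono-< : ∀ {n} (u : Vec ℕ n) {f g} → (∀ k → 1 ≤ lookup u k → f k ≤ g k) →
  ∀ k → 1 ≤ lookup u k → f k < g k → dot u f < dot u g
dot-mono-< (suc x ∷ u) h zero    p q =
  +-mono-<-≤ (*-monoʳ-< (suc x) q) (dot-mono u (h ∘ suc))
dot-mono-< (zero  ∷ u) h (suc k) p q = dot-mono-< u (h ∘ suc) k p q
dot-mono-< (suc x ∷ u) h (suc k) p q =
  +-mono-≤-< (*-monoʳ-≤ (suc x) (h zero (s≤s z≤n))) (dot-mono-< u (h ∘ suc) k p q)

dot-cong : ∀ {n} (u : Vec ℕ n) {f g} →
  (∀ k → 1 ≤ lookup u k → f k ≡ g k) → dot u f ≡ dot u g
dot-cong u h = ≤-antisym (dot-mono u λ k p → ≤-reflexive (h k p))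
                         (dot-mono u λ k p → ≤-reflexive (sym (h k p)))

dot-monoˡ : ∀ {n} (u v : Vec ℕ n) f →
  (∀ k → 1 ≤ f k → lookup u k ≤ lookup v k) → dot u f ≤ dot v f
dot-monoˡ []      []      f h = z≤n
dot-monoˡ (x ∷ u) (y ∷ v) f h with f zero in eq
... | zero  = +-mono-≤ (≤-reflexive (trans (*-zeroʳ x) (sym (*-zeroʳ y)))) (dot-monoˡ u v (f ∘ suc) (h ∘ suc))
... | suc z = +-mono-≤ (*-monoˡ-≤ (suc z) (h zero (subst (1 ≤_) (sym eq) (s≤s z≤n))))
                       (dot-monoˡ u v (f ∘ suc) (h ∘ suc))

dot-monoˡ-< : ∀ {n} (u v : Vec ℕ n) f → (∀ k → 1 ≤ f k → lookup u k ≤ lookup v k) →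
  ∀ k → 1 ≤ f k → lookup u k < lookup v k → dot u f < dot v f
dot-monoˡ-< (x ∷ u) (y ∷ v) f h zero p q =
  +-mono-<-≤ (*-monoˡ-< (f zero) ⦃ >-nonZero p ⦄ q) (dot-monoˡ u v (f ∘ suc) (h ∘ suc))
dot-monoˡ-< (x ∷ u) (y ∷ v) f h (suc k) p q with f zero in eq
... | zero  = +-mono-≤-< (≤-reflexive (trans (*-zeroʳ x) (sym (*-zeroʳ y))))
                         (dot-monoˡ-< u v (f ∘ suc) (h ∘ suc) k p q)
... | suc z = +-mono-≤-< (*-monoˡ-≤ (suc z) (h zero (subst (1 ≤_) (sym eq) (s≤s z≤n))))
                         (dot-monoˡ-< u v (f ∘ suc) (h ∘ suc) k p q)

-- Without such a `k′` the drop at `k` would make the total over `v` strictly smaller. With `f` the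
-- indicator of an index, this finds the next corner of an alternating walk in the same line of the
-- table.
dot-compensate : ∀ {n} (u v : Vec ℕ n) f → dot u f ≡ dot v f →
  ∀ k → 1 ≤ f k → lookup v k < lookup u k → ∃ λ k′ → 1 ≤ f k′ × lookup u k′ < lookup v k′
dot-compensate u v f eq k p q
  with Fin.any? (λ k′ → (1 ≤? f k′) ×-dec (lookup u k′ <? lookup v k′))
... | yes w = w
... | no ∄  = contradiction (sym eq) (<⇒≢ (dot-monoˡ-< v u f (λ k′ p′ → ≮⇒≥ λ q′ → ∄ (k′ , p′ , q′)) k p q))

-- Products of monomials and quadratic monomials

_⊕_ : ∀ {n} → Vec ℕ n → Vec ℕ n → Vec ℕ n
_⊕_ = Vec.zipWith _+_

dot-⊕ : ∀ {n} (u v : Vec ℕ n) f → dot (u ⊕ v) f ≡ dot u f + dot v f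
dot-⊕ []      []      f = refl
dot-⊕ (x ∷ u) (y ∷ v) f = trans
  (cong₂ _+_ (*-distribʳ-+ (f zero) x y) (dot-⊕ u v (f ∘ suc)))
  (interchange (x * f zero) (y * f zero) (dot u (f ∘ suc)) (dot v (f ∘ suc)))

unit : ∀ {n} → Fin n → Vec ℕ n
unit zero    = 1 ∷ Vec.replicate _ 0
unit (suc k) = 0 ∷ unit k

dot-0 : ∀ n f → dot (Vec.replicate n 0) f ≡ 0
dot-0 zero    f = refl
dot-0 (suc n) f = dot-0 n (f ∘ suc)

dot-unit : ∀ {n} (k : Fin n) f → dot (unit k) f ≡ f k
dot-unit {suc n} zero f = trans (cong₂ _+_ (*-identityˡ (f zero)) (dot-0 n (f ∘ suc))) (+-identityʳ (f zero))
dot-unit (suc k) f = dot-unit k (f ∘ suc)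

lookup-unit : ∀ {n} (a b : Fin n) → 1 ≤ lookup (unit a) b → a ≡ b
lookup-unit zero    zero    p = refl
lookup-unit zero    (suc b) p = contradiction p (<⇒≱ (s≤s (≤-reflexive (V-replicate b))))
  where
  V-replicate : ∀ {n} (b : Fin n) → lookup (Vec.replicate n 0) b ≡ 0
  V-replicate zero    = refl
  V-replicate (suc b) = V-replicate b
lookup-unit (suc a) (suc b) p = cong suc (lookup-unit a b p)

unit-lookup : ∀ {n} (a : Fin n) → lookup (unit a) a ≡ 1
unit-lookup zero    = refl
unit-lookup (suc a) = unit-lookup a

lookup-⊕ : ∀ {n} (u v : Vec ℕ n) k → lookup (u ⊕ v) k ≡ lookup u k + lookup v k
lookup-⊕ (x ∷ u) (y ∷ v) zero    = refl
lookup-⊕ (x ∷ u) (y ∷ v) (suc k) = lookup-⊕ u v k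

pair : ∀ {n} → Fin n → Fin n → Vec ℕ n
pair a b = unit a ⊕ unit b

dot-pair : ∀ {n} (a b : Fin n) f → dot (pair a b) f ≡ f a + f b
dot-pair a b f = trans (dot-⊕ (unit a) (unit b) f) (cong₂ _+_ (dot-unit a f) (dot-unit b f))

-- Evaluate both exponents at `a`. Matching this one factor is enough to put a point on both sides
-- of a 4-cycle.
pair-injective : ∀ {n} {a b c d : Fin n} → pair a b ≡ pair c d → c ≡ a ⊎ d ≡ a
pair-injective {a = a} {b} {c} {d} eq with lookup (unit c) a in ca | lookup (unit d) a in da
... | suc _ | _     = inj₁ (lookup-unit c a (subst (1 ≤_) (sym ca) (s≤s z≤n)))
... | zero  | suc _ = inj₂ (lookup-unit d a (subst (1 ≤_) (sym da) (s≤s z≤n)))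
... | zero  | zero  = contradiction
  (trans (sym (lookup-⊕ (unit c) (unit d) a)) (cong (λ u → lookup u a) (sym eq)))
  (λ e → case trans (sym (cong₂ _+_ ca da)) (trans e (trans (lookup-⊕ (unit a) (unit b) a)
           (cong (_+ lookup (unit b) a) (unit-lookup a)))) of λ ())

sum-⊕ : ∀ {n} (u v : Vec ℕ n) → sum (u ⊕ v) ≡ sum u + sum v
sum-⊕ []      []      = refl
sum-⊕ (x ∷ u) (y ∷ v) = trans (cong (x + y +_) (sum-⊕ u v)) (interchange x y (sum u) (sum v))

sum-0 : ∀ n → sum (Vec.replicate n 0) ≡ 0
sum-0 zero    = refl
sum-0 (suc n) = sum-0 n

sum-unit : ∀ {n} (k : Fin n) → sum (unit k) ≡ 1
sum-unit {suc n} zero = cong suc (sum-0 n)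
sum-unit (suc k) = sum-unit k

sum-pair : ∀ {n} (a b : Fin n) → sum (pair a b) ≡ 2
sum-pair a b = trans (sum-⊕ (unit a) (unit b)) (cong₂ _+_ (sum-unit a) (sum-unit b))

⊕-comm : ∀ {n} (u v : Vec ℕ n) → u ⊕ v ≡ v ⊕ u
⊕-comm = zipWith-comm +-comm

⊕-assoc : ∀ {n} (u v t : Vec ℕ n) → (u ⊕ v) ⊕ t ≡ u ⊕ (v ⊕ t)
⊕-assoc = zipWith-assoc +-assoc

unit-divides : ∀ {n} (u : Vec ℕ n) a → 1 ≤ lookup u a → ∃ λ t → unit a ⊕ t ≡ u
unit-divides (suc x ∷ u) zero    p = x ∷ u , cong (suc x ∷_) (zipWith-identityˡ (λ _ → refl) u)
unit-divides (x     ∷ u) (suc a) p = let t , eq = unit-divides u a p in x ∷ t , cong (x ∷_) eq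

pair-divides : ∀ {n} {u : Vec ℕ n} {a b} → a ≢ b → 1 ≤ lookup u a → 1 ≤ lookup u b →
  ∃ λ t → pair a b ⊕ t ≡ u
pair-divides {u = u} {a} {b} a≢b pa pb with unit-divides u a pa
... | t , refl with lookup (unit a) b in eq
...   | suc _ = contradiction (lookup-unit a b (subst (1 ≤_) (sym eq) (s≤s z≤n))) a≢b
...   | zero with unit-divides t b (subst (1 ≤_) (trans (lookup-⊕ (unit a) t b) (cong (_+ lookup t b) eq)) pb)
...     | s , refl = s , ⊕-assoc (unit a) (unit b) s

unit-≤1 : ∀ {n} (a k : Fin n) → lookup (unit a) k ≤ 1
unit-≤1 a k with lookup (unit a) k in eq
... | zero  = z≤n
... | suc _ with lookup-unit a k (subst (1 ≤_) (sym eq) (s≤s z≤n))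
...   | refl = ≤-reflexive (trans (sym eq) (unit-lookup a))

pair-squarefree : ∀ {n} {a b : Fin n} → a ≢ b → ∀ k → lookup (pair a b) k ≤ 1
pair-squarefree {a = a} {b} a≢b k rewrite lookup-⊕ (unit a) (unit b) k
  with lookup (unit a) k in eq
... | zero  = unit-≤1 b k
... | suc _ with lookup-unit a k (subst (1 ≤_) (sym eq) (s≤s z≤n)) | lookup (unit b) k in eq′
...   | refl | zero  = ≤-reflexive (trans (+-identityʳ _) (trans (sym eq) (unit-lookup a)))
...   | refl | suc _ = contradiction (sym (lookup-unit b k (subst (1 ≤_) (sym eq′) (s≤s z≤n)))) a≢b

bit : Bool → ℕ
bit false = 0
bit true  = 1

-- Alternating cycles in 3×3 tables of multiplicities

pigeonhole₃ : (a b c d : Fin 3) → a ≢ b → b ≢ c → c ≢ a → d ≡ a ⊎ d ≡ b ⊎ d ≡ c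
pigeonhole₃ = from-yes pigeonhole₃?
  where
  pigeonhole₃? : Dec ((a b c d : Fin 3) → a ≢ b → b ≢ c → c ≢ a → d ≡ a ⊎ d ≡ b ⊎ d ≡ c)
  pigeonhole₃? = Fin.all? λ a → Fin.all? λ b → Fin.all? λ c → Fin.all? λ d →
    ¬? (a Fin.≟ b) →-dec (¬? (b Fin.≟ c) →-dec (¬? (c Fin.≟ a) →-dec
      ((d Fin.≟ a) ⊎-dec ((d Fin.≟ b) ⊎-dec (d Fin.≟ c)))))

-- The multiplicities of u and v are read as 3×3 tables with rows ι and columns κ.
-- Two tables with equal margins differ along a closed alternating walk, and in a 3×3
-- table such a walk can be shortened to a 4-cycle or is a 6-cycle.
module Tables {n : ℕ} (u v : Fin n → ℕ) (ι κ : Fin n → Fin 3)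
  (joint : ∀ {k k′} → v k < u k → u k′ < v k′ → ι k ≡ ι k′ → κ k ≡ κ k′ → ⊥)
  (ι-uv : ∀ k → v k < u k → ∃ λ k′ → ι k′ ≡ ι k × u k′ < v k′)
  (κ-vu : ∀ k → u k < v k → ∃ λ k′ → κ k′ ≡ κ k × v k′ < u k′)
  (no-4-cycle : ∀ {k₁ k₂ k₃ k₄} → v k₁ < u k₁ → u k₂ < v k₂ → v k₃ < u k₃ → u k₄ < v k₄ →
     ι k₁ ≡ ι k₂ → κ k₂ ≡ κ k₃ → ι k₃ ≡ ι k₄ → κ k₄ ≡ κ k₁ → ⊥)
  (no-6-cycle : ∀ {k₁ k₂ k₃ k₄ k₅ k₆} →
     v k₁ < u k₁ → u k₂ < v k₂ → v k₃ < u k₃ → u k₄ < v k₄ → v k₅ < u k₅ → u k₆ < v k₆ →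
     ι k₁ ≡ ι k₂ → κ k₂ ≡ κ k₃ → ι k₃ ≡ ι k₄ → κ k₄ ≡ κ k₅ → ι k₅ ≡ ι k₆ → κ k₆ ≡ κ k₁ →
     ι k₁ ≢ ι k₃ → ι k₃ ≢ ι k₅ → ι k₅ ≢ ι k₁ →
     κ k₁ ≢ κ k₃ → κ k₃ ≢ κ k₅ → κ k₅ ≢ κ k₁ → ⊥)
  where

  tables-≤ : ∀ k → u k ≤ v k
  tables-≤ k₁ = ≮⇒≥ λ p₁ →
    let k₂ , ι₂ , p₂ = ι-uv k₁ p₁
        k₃ , κ₃ , p₃ = κ-vu k₂ p₂
        k₄ , ι₄ , p₄ = ι-uv k₃ p₃
        k₅ , κ₅ , p₅ = κ-vu k₄ p₄
        k₆ , ι₆ , p₆ = ι-uv k₅ p₅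
    -- Five steps suffice: if the walk does not close earlier, `k₁`, `k₃`, `k₅` occupy all three
    -- columns, so the column of `k₆` is one of theirs. Closing early leaves a 4-cycle, and turning
    -- back at once is excluded by `joint`.
    in case κ k₄ Fin.≟ κ k₁ of λ where
      (yes κ₄₁) → no-4-cycle p₁ p₂ p₃ p₄ (sym ι₂) (sym κ₃) (sym ι₄) κ₄₁
      (no κ₄≢κ₁) → case ι k₅ Fin.≟ ι k₁ of λ where
        (yes ι₅₁) → no-4-cycle p₅ p₂ p₃ p₄ (trans ι₅₁ (sym ι₂)) (sym κ₃) (sym ι₄) (sym κ₅)
        (no ι₅≢ι₁) →
          let κ₁≢κ₃ : κ k₁ ≢ κ k₃
              κ₁≢κ₃ e = joint p₁ p₂ (sym ι₂) (trans e κ₃)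
              κ₃≢κ₅ : κ k₃ ≢ κ k₅
              κ₃≢κ₅ e = joint p₃ p₄ (sym ι₄) (trans e κ₅)
              κ₅≢κ₁ : κ k₅ ≢ κ k₁
              κ₅≢κ₁ e = κ₄≢κ₁ (trans (sym κ₅) e)
              ι₁≢ι₃ : ι k₁ ≢ ι k₃
              ι₁≢ι₃ e = joint p₃ p₂ (trans (sym e) (sym ι₂)) κ₃
              ι₃≢ι₅ : ι k₃ ≢ ι k₅
              ι₃≢ι₅ e = joint p₅ p₄ (trans (sym e) (sym ι₄)) κ₅
          in case pigeonhole₃ (κ k₁) (κ k₃) (κ k₅) (κ k₆) κ₁≢κ₃ κ₃≢κ₅ κ₅≢κ₁ of λ where
            (inj₁ κ₆₁) → no-6-cycle p₁ p₂ p₃ p₄ p₅ p₆ (sym ι₂) (sym κ₃) (sym ι₄) (sym κ₅) (sym ι₆) κ₆₁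
                           ι₁≢ι₃ ι₃≢ι₅ ι₅≢ι₁ κ₁≢κ₃ κ₃≢κ₅ κ₅≢κ₁
            (inj₂ (inj₁ κ₆₃)) → no-4-cycle p₅ p₆ p₃ p₄ (sym ι₆) κ₆₃ (sym ι₄) (sym κ₅)
            (inj₂ (inj₂ κ₆₅)) → joint p₅ p₆ (sym ι₆) (sym κ₆₅)

-- Margins, the quadratic weight and the energy of a difference

Table : Set
Table = Fin 3 → Fin 3 → ℕ

record HasMargins (R C : Fin 3 → ℕ) (m : Table) : Set where
  constructor margins
  field
    row : ∀ i → m i 0F + m i 1F + m i 2F ≡ R i
    col : ∀ j → m 0F j + m 1F j + m 2F j ≡ C j

sumOver : ∀ {A : Set} → List A → (A → ℕ) → ℕ
sumOver []       f = 0
sumOver (x ∷ xs) f = f x + sumOver xs f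

sumOver-mono : ∀ {A : Set} (xs : List A) {f g : A → ℕ} → (∀ {x} → x ∈ xs → f x ≤ g x) →
  sumOver xs f ≤ sumOver xs g
sumOver-mono []       h = z≤n
sumOver-mono (x ∷ xs) h = +-mono-≤ (h (here refl)) (sumOver-mono xs (h ∘ there))

sumOver-gain : ∀ {A : Set} (xs : List A) {f g : A → ℕ} c → (∀ {x} → x ∈ xs → f x ≤ g x) →
  ∀ {x} → x ∈ xs → c + f x ≤ g x → c + sumOver xs f ≤ sumOver xs g
sumOver-gain (x ∷ xs) {f} {g} c h (here refl) q = begin
  c + (f x + sumOver xs f) ≡⟨ sym (+-assoc c (f x) _) ⟩
  c + f x + sumOver xs f   ≤⟨ +-mono-≤ q (sumOver-mono xs (h ∘ there)) ⟩
  g x + sumOver xs g       ∎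
  where open ≤-Reasoning
sumOver-gain (x ∷ xs) {f} {g} c h (there p) q = begin
  c + (f x + sumOver xs f) ≡⟨ x∙yz≈y∙xz c (f x) _ ⟩
  f x + (c + sumOver xs f) ≤⟨ +-mono-≤ (h (here refl)) (sumOver-gain xs c (h ∘ there) p q) ⟩
  g x + sumOver xs g       ∎
  where
  open ≤-Reasoning
  x∙yz≈y∙xz : ∀ a b c → a + (b + c) ≡ b + (a + c)
  x∙yz≈y∙xz = solve-∀

-- The weight is written as a positive combination of squares of linear forms, so that the
-- parallelogram law can be applied term by term.
data Form : Set where
  entry    : Fin 3 × Fin 3 → Form
  diagonal : Form

value : Form → Table → ℕ
value (entry (i , j)) m = m i j
value diagonal        m = m 0F 0F + m 1F 1F

coefficients : List (ℕ × Fin 3 × Fin 3)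
coefficients = (5 , 0F , 0F) ∷ (5 , 0F , 1F) ∷ (5 , 1F , 0F) ∷ (5 , 1F , 1F) ∷ (5 , 2F , 0F) ∷
  (5 , 2F , 1F) ∷ (5 , 2F , 2F) ∷ (1 , 0F , 2F) ∷ (1 , 1F , 2F) ∷ []

-- The large coefficients force the entries of the first two columns to be balanced;
-- the remaining terms orient the relations that this leaves undecided.
forms : List (ℕ × Form)
forms = (3 , diagonal) ∷ map (map₂ entry) coefficients

sq : ℕ → ℕ
sq x = x * x

square : Table → ℕ × Form → ℕ
square m (c , f) = c * sq (value f m)

squareDiff : Table → Table → ℕ × Form → ℕ
squareDiff m n (c , f) = c * sq ∣ value f m - value f n ∣

weight : Table → ℕ
weight m = sumOver forms (square m)

-- The quadratic form behind `weight`, evaluated at the difference of the two tables.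
energy : Table → Table → ℕ
energy m n = sumOver forms (squareDiff m n)

parallelogram : ∀ a b → 2 * (sq a + sq b) ≡ sq (a + b) + sq ∣ a - b ∣
parallelogram a b = case ≤-total a b of λ where
    (inj₁ a≤b) → lemma a b a≤b
    (inj₂ b≤a) → trans (cong (2 *_) (+-comm (sq a) (sq b)))
      (trans (lemma b a b≤a) (cong₂ _+_ (cong sq (+-comm b a)) (cong sq (∣-∣-comm b a))))
  where
  identity : ∀ a d → 2 * (a * a + (a + d) * (a + d)) ≡ (a + (a + d)) * (a + (a + d)) + d * d
  identity = solve-∀
  lemma : ∀ a b → a ≤ b → 2 * (sq a + sq b) ≡ sq (a + b) + sq ∣ a - b ∣
  lemma a b a≤b = subst (λ b → 2 * (sq a + sq b) ≡ sq (a + b) + sq ∣ a - b ∣) (m+[n∸m]≡n a≤b)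
    (trans (identity a (b ∸ a)) (cong (λ d → sq (a + (a + (b ∸ a))) + sq d) (sym (∣m-m+n∣≡n a (b ∸ a)))))

exchange-sq : ∀ e {a b c d : ℕ} → a + b ≡ c + d →
  2 * (e * sq a + e * sq b) + e * sq ∣ c - d ∣ ≡ 2 * (e * sq c + e * sq d) + e * sq ∣ a - b ∣
exchange-sq e {a} {b} {c} {d} eq = begin
  2 * (e * sq a + e * sq b) + e * sq ∣ c - d ∣ ≡⟨ factor e (sq a) (sq b) (sq ∣ c - d ∣) ⟩
  e * (2 * (sq a + sq b) + sq ∣ c - d ∣)       ≡⟨ cong (e *_) swapped ⟩
  e * (2 * (sq c + sq d) + sq ∣ a - b ∣)       ≡⟨ sym (factor e (sq c) (sq d) (sq ∣ a - b ∣)) ⟩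
  2 * (e * sq c + e * sq d) + e * sq ∣ a - b ∣ ∎
  where
  open ≡-Reasoning
  factor : ∀ e x y z → 2 * (e * x + e * y) + e * z ≡ e * (2 * (x + y) + z)
  factor = solve-∀
  rotate : ∀ x y z → x + y + z ≡ x + z + y
  rotate = solve-∀
  swapped : 2 * (sq a + sq b) + sq ∣ c - d ∣ ≡ 2 * (sq c + sq d) + sq ∣ a - b ∣
  swapped = trans (cong (_+ sq ∣ c - d ∣) (trans (parallelogram a b) (cong (λ s → sq s + sq ∣ a - b ∣) eq)))
    (trans (rotate (sq (c + d)) (sq ∣ a - b ∣) (sq ∣ c - d ∣))
      (cong (_+ sq ∣ a - b ∣) (sym (parallelogram c d))))

SameSum : (m n m′ n′ : Table) → Set
SameSum m n m′ n′ = ∀ i j → m i j + n i j ≡ m′ i j + n′ i j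

value-additive : ∀ m n m′ n′ → SameSum m n m′ n′ →
  ∀ f → value f m + value f n ≡ value f m′ + value f n′
value-additive m n m′ n′ eq (entry (i , j)) = eq i j
value-additive m n m′ n′ eq diagonal = trans (shuffle (m 0F 0F) _ _ _)
  (trans (cong₂ _+_ (eq 0F 0F) (eq 1F 1F)) (sym (shuffle (m′ 0F 0F) _ _ _)))
  where
  shuffle : ∀ a b c d → a + b + (c + d) ≡ a + c + (b + d)
  shuffle = solve-∀

-- For a quadratic form `q`, 2(q(m) + q(n)) = q(m + n) + q(m - n), and the sum is common to both
-- pairs. Hence two quadratic monomials of one fibre are compared through differences alone, which
-- is what later allows a finite check for all margins.
weight-energy : ∀ m n m′ n′ → SameSum m n m′ n′ →
  2 * (weight m + weight n) + energy m′ n′ ≡ 2 * (weight m′ + weight n′) + energy m n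
weight-energy m n m′ n′ eq = go forms
  where
  regroup : ∀ a b c d x y → 2 * (a + b + (c + d)) + (x + y) ≡ (2 * (a + c) + x) + (2 * (b + d) + y)
  regroup = solve-∀
  go : ∀ xs → 2 * (sumOver xs (square m) + sumOver xs (square n)) + sumOver xs (squareDiff m′ n′) ≡
    2 * (sumOver xs (square m′) + sumOver xs (square n′)) + sumOver xs (squareDiff m n)
  go []             = refl
  go ((c , f) ∷ xs) = trans
    (regroup (square m (c , f)) (sumOver xs (square m)) (square n (c , f)) (sumOver xs (square n)) _ _)
    (trans (cong₂ _+_ (exchange-sq c {value f m} {value f n} {value f m′} {value f n′} (value-additive m n m′ n′ eq f)) (go xs))
      (sym (regroup (square m′ (c , f)) (sumOver xs (square m′)) (square n′ (c , f)) (sumOver xs (square n′)) _ _)))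

energy⇒weight : ∀ m n m′ n′ → SameSum m n m′ n′ → energy m′ n′ < energy m n →
  weight m′ + weight n′ < weight m + weight n
energy⇒weight m n m′ n′ eq lt = *-cancelˡ-< 2 _ _ (+-cancelʳ-< (energy m n) _ _ (begin-strict
  2 * (weight m′ + weight n′) + energy m n ≡⟨ sym (weight-energy m n m′ n′ eq) ⟩
  2 * (weight m + weight n) + energy m′ n′ <⟨ +-monoʳ-< (2 * (weight m + weight n)) lt ⟩
  2 * (weight m + weight n) + energy m n   ∎))
  where open ≤-Reasoning

-- Rounding the average of two tables

-- A 0/1 table is stored as a subset of its nine cells so that `anySubset?` can search through all
-- of them.
at : Vec Bool 9 → Table
at p i j = bit (lookup p (Fin.combine i j))

private
  Even : Vec Bool 9 → Set
  Even p = (∀ i → 2 ∣ at p i 0F + at p i 1F + at p i 2F) × (∀ j → 2 ∣ at p 0F j + at p 1F j + at p 2F j)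

  Half : Vec Bool 9 → Vec Bool 9 → Set
  Half p a = (∀ i j → at a i j ≤ at p i j) ×
    (∀ i → 2 * (at a i 0F + at a i 1F + at a i 2F) ≡ at p i 0F + at p i 1F + at p i 2F) ×
    (∀ j → 2 * (at a 0F j + at a 1F j + at a 2F j) ≡ at p 0F j + at p 1F j + at p 2F j)

  half? : ∀ p a → Dec (Half p a)
  half? p a = (Fin.all? λ i → Fin.all? λ j → _ ≤? _) ×-dec ((Fin.all? λ i → _ ≟ _) ×-dec (Fin.all? λ j → _ ≟ _))

  halving? : ∀ p → Dec (Even p → ∃ (Half p))
  halving? p = ((Fin.all? λ i → _ ∣? _) ×-dec (Fin.all? λ j → _ ∣? _)) →-dec anySubset? (half? p)

  no-counterexample : ¬ ∃ λ p → ¬ (Even p → ∃ (Half p))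
  no-counterexample = from-no (anySubset? λ p → ¬? (halving? p))

-- An even pattern has no or two cells in every row and column, so it is a disjoint union of closed
-- rook walks of even length; taking every other cell halves it. Here the 512 patterns are simply
-- searched for a counterexample.
halving : ∀ p → Even p → ∃ (Half p)
halving p = decidable-stable (halving? p) λ ¬h → no-counterexample (p , ¬h)

odd : ℕ → Bool
odd 0             = false
odd 1             = true
odd (suc (suc n)) = odd n

odd-half : ∀ n → bit (odd n) + 2 * ⌊ n /2⌋ ≡ n
odd-half 0             = refl
odd-half 1             = refl
odd-half (suc (suc n)) = trans (shift (bit (odd n)) ⌊ n /2⌋) (cong 2+ (odd-half n))
  where
  shift : ∀ b h → b + 2 * suc h ≡ suc (suc (b + 2 * h))
  shift = solve-∀

odd-double : ∀ n → odd (n + n) ≡ false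
odd-double zero    = refl
odd-double (suc n) rewrite +-suc n n = odd-double n

bit≤1 : ∀ b → bit b ≤ 1
bit≤1 false = z≤n
bit≤1 true  = s≤s z≤n

at≤1 : ∀ p i j → at p i j ≤ 1
at≤1 p i j = bit≤1 (lookup p (Fin.combine i j))

∣-∣≤1 : ∀ {a b} → a ≤ 1 → b ≤ 1 → ∣ a - b ∣ ≤ 1
∣-∣≤1 z≤n       z≤n       = z≤n
∣-∣≤1 z≤n       (s≤s z≤n) = s≤s z≤n
∣-∣≤1 (s≤s z≤n) z≤n       = s≤s z≤n
∣-∣≤1 (s≤s z≤n) (s≤s z≤n) = z≤n

-- (m + n) / 2 can be rounded: the odd entries of m + n occupy an even number of places in
-- each row and column, and half of them can be rounded up in all rows and columns at once.
record Rounding (R C : Fin 3 → ℕ) (m n : Table) : Set where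
  field
    up down      : Table
    up-margins   : HasMargins R C up
    down-margins : HasMargins R C down
    same-sum     : SameSum m n up down
    near         : ∀ i j → ∣ up i j - down i j ∣ ≤ 1
    fixes        : ∀ i j → m i j ≡ n i j → up i j ≡ down i j

rounding : ∀ {R C m n} → HasMargins R C m → HasMargins R C n → Rounding R C m n
rounding {R} {C} {m} {n} mm mn = record
  { up           = up
  ; down         = down
  ; up-margins   = margins
      (λ i → up-line (S i 0F) (S i 1F) (S i 2F) (at a i 0F) (at a i 1F) (at a i 2F)
               (trans (a-row i) (p-line (at-p i 0F) (at-p i 1F) (at-p i 2F))) (S-row i))
      (λ j → up-line (S 0F j) (S 1F j) (S 2F j) (at a 0F j) (at a 1F j) (at a 2F j)
               (trans (a-col j) (p-line (at-p 0F j) (at-p 1F j) (at-p 2F j))) (S-col j))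
  ; down-margins = margins
      (λ i → down-line (up i 0F) (up i 1F) (up i 2F) (sum-eq i 0F) (sum-eq i 1F) (sum-eq i 2F)
        (up-line (S i 0F) (S i 1F) (S i 2F) (at a i 0F) (at a i 1F) (at a i 2F)
               (trans (a-row i) (p-line (at-p i 0F) (at-p i 1F) (at-p i 2F))) (S-row i)) (S-row i))
      (λ j → down-line (up 0F j) (up 1F j) (up 2F j) (sum-eq 0F j) (sum-eq 1F j) (sum-eq 2F j)
        (up-line (S 0F j) (S 1F j) (S 2F j) (at a 0F j) (at a 1F j) (at a 2F j)
               (trans (a-col j) (p-line (at-p 0F j) (at-p 1F j) (at-p 2F j))) (S-col j)) (S-col j))
  ; same-sum     = λ i j → sym (sum-eq i j)
  ; near         = λ i j → subst (_≤ 1) (sym (∣m+n-m+o∣≡∣n-o∣ ⌊ S i j /2⌋ (at a i j) (at p i j ∸ at a i j)))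
                     (∣-∣≤1 (at≤1 a i j) (≤-trans (m∸n≤m (at p i j) (at a i j)) (at≤1 p i j)))
  ; fixes        = fixes
  }
  where
  S : Table
  S i j = m i j + n i j
  oddAt : Fin 3 × Fin 3 → Bool
  oddAt (i , j) = odd (S i j)
  p : Vec Bool 9
  p = Vec.tabulate (oddAt ∘ Fin.remQuot 3)
  at-p : ∀ i j → at p i j ≡ bit (odd (S i j))
  at-p i j = trans (cong bit (lookup∘tabulate (oddAt ∘ Fin.remQuot 3) (Fin.combine i j)))
    (cong (bit ∘ oddAt) (Fin.remQuot-combine i j))
  S-row : ∀ i → S i 0F + S i 1F + S i 2F ≡ 2 * R i
  S-row i = trans (regroup (m i 0F) _ _ _ _ _)
    (trans (cong₂ _+_ (HasMargins.row mm i) (HasMargins.row mn i)) (cong (R i +_) (sym (+-identityʳ (R i)))))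
    where
    regroup : ∀ a b c d e f → a + b + (c + d) + (e + f) ≡ a + c + e + (b + d + f)
    regroup = solve-∀
  S-col : ∀ j → S 0F j + S 1F j + S 2F j ≡ 2 * C j
  S-col j = trans (regroup (m 0F j) _ _ _ _ _)
    (trans (cong₂ _+_ (HasMargins.col mm j) (HasMargins.col mn j)) (cong (C j +_) (sym (+-identityʳ (C j)))))
    where
    regroup : ∀ a b c d e f → a + b + (c + d) + (e + f) ≡ a + c + e + (b + d + f)
    regroup = solve-∀
  p-line : ∀ {a b c a′ b′ c′ : ℕ} → a ≡ a′ → b ≡ b′ → c ≡ c′ → a + b + c ≡ a′ + b′ + c′
  p-line refl refl refl = refl
  parity-split : ∀ x y z →
    2 * (⌊ x /2⌋ + ⌊ y /2⌋ + ⌊ z /2⌋) + (bit (odd x) + bit (odd y) + bit (odd z)) ≡ x + y + z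
  parity-split x y z = trans (regroup ⌊ x /2⌋ ⌊ y /2⌋ ⌊ z /2⌋ (bit (odd x)) (bit (odd y)) (bit (odd z)))
    (p-line (odd-half x) (odd-half y) (odd-half z))
    where
    regroup : ∀ a b c d e f → 2 * (a + b + c) + (d + e + f) ≡ d + 2 * a + (e + 2 * b) + (f + 2 * c)
    regroup = solve-∀
  even-line : ∀ x y z {r} → x + y + z ≡ 2 * r → 2 ∣ bit (odd x) + bit (odd y) + bit (odd z)
  even-line x y z {r} eq = ∣m+n∣m⇒∣n
    (subst (2 ∣_) (sym (trans (parity-split x y z) eq)) (m∣m*n r)) (m∣m*n (⌊ x /2⌋ + ⌊ y /2⌋ + ⌊ z /2⌋))
  half : ∃ (Half p)
  half = halving p
    ( (λ i → subst (2 ∣_) (sym (p-line (at-p i 0F) (at-p i 1F) (at-p i 2F)))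
               (even-line (S i 0F) (S i 1F) (S i 2F) {R i} (S-row i)))
    , (λ j → subst (2 ∣_) (sym (p-line (at-p 0F j) (at-p 1F j) (at-p 2F j)))
               (even-line (S 0F j) (S 1F j) (S 2F j) {C j} (S-col j))))
  a : Vec Bool 9
  a = proj₁ half
  a≤p : ∀ i j → at a i j ≤ at p i j
  a≤p = proj₁ (proj₂ half)
  a-row = proj₁ (proj₂ (proj₂ half))
  a-col = proj₂ (proj₂ (proj₂ half))
  up down : Table
  up   i j = ⌊ S i j /2⌋ + at a i j
  down i j = ⌊ S i j /2⌋ + (at p i j ∸ at a i j)
  sum-eq : ∀ i j → up i j + down i j ≡ S i j
  sum-eq i j = begin
    h + at a i j + (h + (at p i j ∸ at a i j)) ≡⟨ regroup h (at a i j) (at p i j ∸ at a i j) ⟩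
    (at a i j + (at p i j ∸ at a i j)) + 2 * h ≡⟨ cong (_+ 2 * h) (m+[n∸m]≡n (a≤p i j)) ⟩
    at p i j + 2 * h                           ≡⟨ cong (_+ 2 * h) (at-p i j) ⟩
    bit (odd (S i j)) + 2 * h                  ≡⟨ odd-half (S i j) ⟩
    S i j                                      ∎
    where
    open ≡-Reasoning
    h : ℕ
    h = ⌊ S i j /2⌋
    regroup : ∀ h a b → h + a + (h + b) ≡ (a + b) + 2 * h
    regroup = solve-∀
  up-line : ∀ x y z a b c {r} → 2 * (a + b + c) ≡ bit (odd x) + bit (odd y) + bit (odd z) → x + y + z ≡ 2 * r →
    (⌊ x /2⌋ + a) + (⌊ y /2⌋ + b) + (⌊ z /2⌋ + c) ≡ r
  up-line x y z a b c {r} eq₁ eq₂ = *-cancelˡ-≡ _ _ 2 (trans (regroup ⌊ x /2⌋ ⌊ y /2⌋ ⌊ z /2⌋ a b c)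
    (trans (cong (2 * (⌊ x /2⌋ + ⌊ y /2⌋ + ⌊ z /2⌋) +_) eq₁) (trans (parity-split x y z) eq₂)))
    where
    regroup : ∀ a b c d e f → 2 * (a + d + (b + e) + (c + f)) ≡ 2 * (a + b + c) + 2 * (d + e + f)
    regroup = solve-∀
  down-line : ∀ a b c {d e f x y z r : ℕ} → a + d ≡ x → b + e ≡ y → c + f ≡ z →
    a + b + c ≡ r → x + y + z ≡ 2 * r → d + e + f ≡ r
  down-line a b c {d} {e} {f} refl refl refl refl eq = +-cancelˡ-≡ (a + b + c) _ _
    (trans (regroup a b c d e f) (trans eq (cong (a + b + c +_) (+-identityʳ (a + b + c)))))
    where
    regroup : ∀ a b c d e f → a + b + c + (d + e + f) ≡ a + d + (b + e) + (c + f)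
    regroup = solve-∀
  fixes : ∀ i j → m i j ≡ n i j → up i j ≡ down i j
  fixes i j eq = cong (⌊ S i j /2⌋ +_) (trans a≡0 (sym (trans (cong (_∸ at a i j) p≡0) (0∸n≡0 (at a i j)))))
    where
    p≡0 : at p i j ≡ 0
    p≡0 = trans (at-p i j) (cong bit (trans (cong (λ x → odd (m i j + x)) (sym eq)) (odd-double (m i j))))
    a≡0 : at a i j ≡ 0
    a≡0 = n≤0⇒n≡0 (subst (at a i j ≤_) p≡0 (a≤p i j))

-- The finite check on 6-cycles

next : Fin 3 → Fin 3
next 0F = 1F
next 1F = 2F
next 2F = 0F

-- A column that is constant up to one unit: direction true raises the entry in row i,
-- direction false lowers it (relative to a base one unit higher).
spike : Bool → Fin 3 → Fin 3 → ℕ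
spike s i r = if does (i Fin.≟ r) then bit s else bit (not s)

-- The last column records by how much the first two lower the last column of a lattice point.
cell : Bool → Bool → Fin 3 → Fin 3 → Table
cell s t i j r 0F = spike s i r
cell s t i j r 1F = spike t j r
cell s t i j r 2F = spike s i r + spike t j r

-- `α` and `β` list the exceptional rows of the first and second column in the order of the cycle.
-- The points of one monomial (side `true`) combine `α x` with `β x`, those of the other combine
-- `α x` with `β (next x)`.
module Hexagon (s t : Bool) (α β : Fin 3 → Fin 3) where

  partner : Bool → Fin 3 → Fin 3
  partner true  x = x
  partner false x = next x

  vertex : Bool → Fin 3 → Table
  vertex side x = cell s t (α x) (β (partner side x))

  -- All six vertices come from lattice points with a nonnegative last column, so each row can
  -- certainly afford the largest loss among them.
  reach : Fin 3 → ℕ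
  reach r = corner true ⊔ corner false
    where
    corner : Bool → ℕ
    corner side = vertex side 0F r 2F ⊔ vertex side 1F r 2F ⊔ vertex side 2F r 2F

  -- bound r is what the last column can afford to lose in row r.
  Improvable : (Fin 3 → ℕ) → Bool → Fin 3 → Set
  Improvable bound side x =
    (∀ r → cell s t (α x) (β q) r 2F ≤ bound r) × (∀ r → cell s t (α y) (β p) r 2F ≤ bound r) ×
    energy (cell s t (α x) (β q)) (cell s t (α y) (β p)) < energy (cell s t (α x) (β p)) (cell s t (α y) (β q))
    where
    y p q : Fin 3
    y = next x
    p = partner side x
    q = partner side y

  Refutable : (Fin 3 → ℕ) → Set
  Refutable bound = (∃ λ x → Improvable bound true x) ⊎ (∃ λ x → Improvable bound false x)

  raise : Fin 3 → Fin 3 → ℕ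
  raise i r = if does (i Fin.≟ r) then suc (reach r) else reach r

  Tight : Bool → Fin 3 → Set
  Tight side x = vertex side x 0F 2F ≡ reach 0F × vertex side x 1F 2F ≡ reach 1F

  -- In the second case no swap is affordable at once, but one is as soon as either of the first
  -- two rows affords one more; a tight point whose last column is positive in one of these rows
  -- shows that this row does.
  Verdict : Set
  Verdict = Refutable reach ⊎
    (Refutable (raise 0F) × Refutable (raise 1F) × ((∃ λ x → Tight true x) ⊎ (∃ λ x → Tight false x)))

  improvable? : ∀ bound side x → Dec (Improvable bound side x)
  improvable? bound side x =
    (Fin.all? λ r → _ ≤? _) ×-dec ((Fin.all? λ r → _ ≤? _) ×-dec (_ <? _))

  refutable? : ∀ bound → Dec (Refutable bound)
  refutable? bound = Fin.any? (improvable? bound true) ⊎-dec Fin.any? (improvable? bound false)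

  verdict? : Dec Verdict
  verdict? = refutable? reach ⊎-dec (refutable? (raise 0F) ×-dec (refutable? (raise 1F) ×-dec
    (Fin.any? (λ x → (_ ≟ _) ×-dec (_ ≟ _)) ⊎-dec Fin.any? (λ x → (_ ≟ _) ×-dec (_ ≟ _)))))

triple : ∀ {A : Set} → A → A → A → Fin 3 → A
triple a b c = lookup (a ∷ b ∷ c ∷ [])

private
  Verdicts : Bool → Bool → Set
  Verdicts s t = ∀ a₀ a₁ a₂ → a₀ ≢ a₁ → a₁ ≢ a₂ → a₂ ≢ a₀ → ∀ b₀ b₁ b₂ → b₀ ≢ b₁ → b₁ ≢ b₂ → b₂ ≢ b₀ →
    Hexagon.Verdict s t (triple a₀ a₁ a₂) (triple b₀ b₁ b₂)

  distinct? : {P : Fin 3 → Fin 3 → Fin 3 → Set} → (∀ a b c → Dec (P a b c)) →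
    Dec (∀ a b c → a ≢ b → b ≢ c → c ≢ a → P a b c)
  distinct? P? = Fin.all? λ a → Fin.all? λ b → Fin.all? λ c →
    ¬? (a Fin.≟ b) →-dec (¬? (b Fin.≟ c) →-dec (¬? (c Fin.≟ a) →-dec P? a b c))

  verdicts? : ∀ s t → Dec (Verdicts s t)
  verdicts? s t = distinct? λ a₀ a₁ a₂ → distinct? λ b₀ b₁ b₂ →
    Hexagon.verdict? s t (triple a₀ a₁ a₂) (triple b₀ b₁ b₂)

-- Energies see only differences, so the bases of the columns have cancelled and 4 · 6 · 6
-- configurations stand for all margins.
verdicts : ∀ s t → Verdicts s t
verdicts false false = from-yes (verdicts? false false)
verdicts false true  = from-yes (verdicts? false true)
verdicts true  false = from-yes (verdicts? true  false)
verdicts true  true  = from-yes (verdicts? true  true)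

-- The weighted lexicographic term order

module MonomialOrder {n : ℕ} (w : Fin n → ℕ) where

  _<ₗ_ : ∀ {k} → Vec ℕ k → Vec ℕ k → Set
  _<ₗ_ = Lex.Lex-< _≡_ _<_

  -- With the weight as an extra leading coordinate, the order is a plain lexicographic order on
  -- vectors of fixed length and inherits totality and well-foundedness from it.
  weighted : Vec ℕ n → Vec ℕ (suc n)
  weighted u = dot u w ∷ u

  infix 4 _≺_
  _≺_ : Vec ℕ n → Vec ℕ n → Set
  _≺_ = _<ₗ_ on weighted

  _≺?_ : ∀ u v → Dec (u ≺ v)
  u ≺? v = Lex.<-decidable _≟_ _<?_ (weighted u) (weighted v)

  lighter⇒≺ : ∀ {u v} → dot u w < dot v w → u ≺ v
  lighter⇒≺ p = Lex.this p refl

  ≺-wellFounded : WellFounded _≺_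
  ≺-wellFounded = On.wellFounded weighted
    (Lex.<-wellFounded trans (λ { refl p → p }) <-wellFounded)

  ≺-compare : ∀ u v → Tri (u ≺ v) (u ≡ v) (v ≺ u)
  ≺-compare u v with Lex.<-cmp sym <-cmp (weighted u) (weighted v)
  ... | tri< a ¬b ¬c = tri< a (λ { refl → ¬b (Pointwise.refl refl) }) ¬c
  ... | tri≈ ¬a b ¬c = tri≈ ¬a (proj₂ (∷-injective (Pointwise.Pointwise-≡⇒≡ b))) ¬c
  ... | tri> ¬a ¬b c = tri> ¬a (λ { refl → ¬b (Pointwise.refl refl) }) c

  ≺-irrefl : ∀ {u} → ¬ (u ≺ u)
  ≺-irrefl = Lex.<-irrefl <-irrefl (Pointwise.refl refl)

  ≺-trans : ∀ {u v t} → u ≺ v → v ≺ t → u ≺ t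
  ≺-trans = Lex.<-trans (IsEquivalence.isPartialEquivalence isEquivalence) (resp₂ _<_) <-trans

  ≺-isStrictTotalOrder : IsStrictTotalOrder _≡_ _≺_
  ≺-isStrictTotalOrder = record
    { isStrictPartialOrder = record
      { isEquivalence = isEquivalence
      ; irrefl        = λ { refl → ≺-irrefl }
      ; trans         = λ {u} {v} {t} → ≺-trans {u} {v} {t}
      ; <-resp-≈      = resp₂ _≺_
      }
    ; compare = ≺-compare
    }

  ⊕-monoˡ-<ₗ : ∀ {k} {u v : Vec ℕ k} t → u <ₗ v → (u ⊕ t) <ₗ (v ⊕ t)
  ⊕-monoˡ-<ₗ []      (Lex.base ())
  ⊕-monoˡ-<ₗ (z ∷ t) (Lex.this p _)    = Lex.this (+-monoˡ-< z p) refl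
  ⊕-monoˡ-<ₗ (z ∷ t) (Lex.next refl p) = Lex.next refl (⊕-monoˡ-<ₗ t p)

  ⊕-monoˡ-≺ : ∀ u v t → u ≺ v → (u ⊕ t) ≺ (v ⊕ t)
  ⊕-monoˡ-≺ u v t p = subst₂ (λ x y → (x ∷ u ⊕ t) <ₗ (y ∷ v ⊕ t))
    (sym (dot-⊕ u t w)) (sym (dot-⊕ v t w)) (⊕-monoˡ-<ₗ (weighted t) p)

  0-least-<ₗ : ∀ {k} (u : Vec ℕ k) → u ≢ Vec.replicate k 0 → Vec.replicate k 0 <ₗ u
  0-least-<ₗ []          u≢0 = contradiction refl u≢0
  0-least-<ₗ (zero  ∷ u) u≢0 = Lex.next refl (0-least-<ₗ u (u≢0 ∘ cong (0 ∷_)))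
  0-least-<ₗ (suc x ∷ u) u≢0 = Lex.this (s≤s z≤n) refl

  0-least-≺ : ∀ u → u ≢ Vec.replicate n 0 → Vec.replicate n 0 ≺ u
  0-least-≺ u u≢0 = subst (λ x → (x ∷ Vec.replicate n 0) <ₗ weighted u) (sym (dot-0 n w))
    (0-least-<ₗ (weighted u) (u≢0 ∘ proj₂ ∘ ∷-injective))

-- Balanced columns and their three possible shapes

-- The average of `f` lies in [q, q + 1). A value below `q` would keep all others at most `q` and
-- the average below `q`; a value above `q + 1` would keep all others at least `q + 1`.
window : ∀ {n} (u : Vec ℕ n) (f : Fin n → ℕ) q →
  (∀ a b → 1 ≤ lookup u a → 1 ≤ lookup u b → ∣ f a - f b ∣ ≤ 1) →
  sum u * q ≤ dot u f → dot u f < sum u * suc q →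
  ∀ k → 1 ≤ lookup u k → q ≤ f k × f k ≤ suc q
window u f q near lo hi k p = ≮⇒≥ below , ≮⇒≥ above
  where
  open ≤-Reasoning
  below : ¬ f k < q
  below lt = <-irrefl refl (begin-strict
    dot u f         <⟨ dot-mono-< u (λ a pa → ≤-trans (close a pa) lt) k p lt ⟩
    dot u (λ _ → q) ≡⟨ dot-const u q ⟩
    sum u * q       ≤⟨ lo ⟩
    dot u f         ∎)
    where
    close : ∀ a → 1 ≤ lookup u a → f a ≤ suc (f k)
    close a pa = ≤-trans (m≤n+∣m-n∣ (f a) (f k)) (≤-trans (+-monoʳ-≤ (f k) (near a k pa p)) (≤-reflexive (+-comm (f k) 1)))
  above : ¬ suc q < f k
  above lt = <-irrefl refl (begin-strict
    dot u f             <⟨ hi ⟩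
    sum u * suc q       ≡⟨ sym (dot-const u (suc q)) ⟩
    dot u (λ _ → suc q) ≤⟨ dot-mono u (λ a pa → s≤s⁻¹ (≤-trans lt (close a pa))) ⟩
    dot u f             ∎)
    where
    close : ∀ a → 1 ≤ lookup u a → f k ≤ suc (f a)
    close a pa = ≤-trans (m≤n+∣m-n∣ (f k) (f a)) (≤-trans (+-monoʳ-≤ (f a) (near k a p pa)) (≤-reflexive (+-comm (f a) 1)))

indicator : Fin 3 → Fin 3 → ℕ
indicator = spike true

indicator-refl : ∀ i → 1 ≤ indicator i i
indicator-refl = from-yes (Fin.all? λ i → 1 ≤? indicator i i)

indicator-sound : ∀ i j → 1 ≤ indicator i j → i ≡ j
indicator-sound = from-yes indicator-sound?
  where
  indicator-sound? : Dec (∀ i j → 1 ≤ indicator i j → i ≡ j)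
  indicator-sound? = Fin.all? λ i → Fin.all? λ j → (1 ≤? indicator i j) →-dec (i Fin.≟ j)

indicator-complement : ∀ i j → indicator i j + spike false i j ≡ 1
indicator-complement = from-yes (Fin.all? λ i → Fin.all? λ j → indicator i j + spike false i j ≟ 1)

-- The 0/1 columns of sum t, indexed by their exceptional row if they have one.
profile : ℕ → Fin 3 → Fin 3 → ℕ
profile 0 i r = 0
profile 1 i r = spike true i r
profile 2 i r = spike false i r
profile _ i r = 1

firstOne firstZero : ℕ → ℕ → Fin 3
firstOne 1 _ = 0F
firstOne _ 1 = 1F
firstOne _ _ = 2F
firstZero 0 _ = 0F
firstZero _ 0 = 1F
firstZero _ _ = 2F

-- Kinds other than 1 and 2 have no exceptional row. The constant default `0F` makes all indices
-- agree there, so two different indices certify a genuine spike.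
peak : ℕ → ℕ → ℕ → Fin 3
peak 1 = firstOne
peak 2 = firstZero
peak _ = λ _ _ → 0F

profile-bits : ∀ {x y z} → x ≤ 1 → y ≤ 1 → z ≤ 1 → ∀ {t} → x + y + z ≡ t →
  ∀ r → triple x y z r ≡ profile t (peak t x y) r
profile-bits z≤n       z≤n       z≤n       refl = λ { 0F → refl ; 1F → refl ; 2F → refl }
profile-bits z≤n       z≤n       (s≤s z≤n) refl = λ { 0F → refl ; 1F → refl ; 2F → refl }
profile-bits z≤n       (s≤s z≤n) z≤n       refl = λ { 0F → refl ; 1F → refl ; 2F → refl }
profile-bits z≤n       (s≤s z≤n) (s≤s z≤n) refl = λ { 0F → refl ; 1F → refl ; 2F → refl }
profile-bits (s≤s z≤n) z≤n       z≤n       refl = λ { 0F → refl ; 1F → refl ; 2F → refl }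
profile-bits (s≤s z≤n) z≤n       (s≤s z≤n) refl = λ { 0F → refl ; 1F → refl ; 2F → refl }
profile-bits (s≤s z≤n) (s≤s z≤n) z≤n       refl = λ { 0F → refl ; 1F → refl ; 2F → refl }
profile-bits (s≤s z≤n) (s≤s z≤n) (s≤s z≤n) refl = λ { 0F → refl ; 1F → refl ; 2F → refl }

triple-η : ∀ {A : Set} (f : Fin 3 → A) r → triple (f 0F) (f 1F) (f 2F) r ≡ f r
triple-η f 0F = refl
triple-η f 1F = refl
triple-η f 2F = refl

Supp : ∀ {n} → Vec ℕ n → Vec ℕ n → Fin n → Set
Supp u v k = 1 ≤ lookup u k ⊎ 1 ≤ lookup v k

-- One `base` and one `kind` serve both monomials, since these depend only on the fibre. `balance`
-- says that the two tables of multiplicities have the same margins in this direction.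
record Spikes {n} (u v : Vec ℕ n) (x : Fin 3 → Fin n → ℕ) : Set where
  field
    base    : Fin 3 → ℕ
    kind    : ℕ
    index   : Fin n → Fin 3
    shape   : ∀ k → Supp u v k → ∀ r → x r k ≡ base r + profile kind (index k) r
    spiky   : ∀ {k k′} → index k ≢ index k′ → ∃ λ s → ∀ i r → profile kind i r ≡ spike s i r
    balance : ∀ i → dot u (λ k → indicator (index k) i) ≡ dot v (λ k → indicator (index k) i)

  partner : ∀ k → lookup v k < lookup u k → ∃ λ k′ → index k′ ≡ index k × lookup u k′ < lookup v k′
  partner k p =
    let k′ , q , lt = dot-compensate u v _ (balance (index k)) k (indicator-refl (index k)) p
    in k′ , indicator-sound (index k′) (index k) q , lt

  partner′ : ∀ k → lookup u k < lookup v k → ∃ λ k′ → index k′ ≡ index k × lookup v k′ < lookup u k′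
  partner′ k p =
    let k′ , q , lt = dot-compensate v u _ (sym (balance (index k))) k (indicator-refl (index k)) p
    in k′ , indicator-sound (index k′) (index k) q , lt

module _ {n} (u v : Vec ℕ n) (deg : sum u ≡ sum v) (0<deg : 0 < sum u)
  (x : Fin 3 → Fin n → ℕ) (sums : ∀ r → dot u (x r) ≡ dot v (x r))
  (total : ℕ) (column : ∀ k → x 0F k + x 1F k + x 2F k ≡ total)
  (near-u : ∀ r a b → 1 ≤ lookup u a → 1 ≤ lookup u b → ∣ x r a - x r b ∣ ≤ 1)
  (near-v : ∀ r a b → 1 ≤ lookup v a → 1 ≤ lookup v b → ∣ x r a - x r b ∣ ≤ 1) where

  private
    instance
      deg-nonZero : NonZero (sum u)
      deg-nonZero = >-nonZero 0<deg

    -- The floor of the average entry in row `r`; degree and entry totals agree, so it is the same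
    -- for `v`.
    q : Fin 3 → ℕ
    q r = dot u (x r) / sum u

    q-lower : ∀ r → sum u * q r ≤ dot u (x r)
    q-lower r = subst (_≤ dot u (x r)) (*-comm (q r) (sum u)) (m/n*n≤m (dot u (x r)) (sum u))

    q-upper : ∀ r → dot u (x r) < sum u * suc (q r)
    q-upper r = subst (dot u (x r) <_) (*-comm (suc (q r)) (sum u)) (m<[1+n]*o′ (dot u (x r)))
      where
      m<[1+n]*o′ : ∀ m → m < suc (m / sum u) * sum u
      m<[1+n]*o′ m = subst (_< suc (m / sum u) * sum u) (sym (m≡m%n+[m/n]*n m (sum u)))
        (+-monoˡ-< (m / sum u * sum u) (m%n<n m (sum u)))

    in-window : ∀ r k → Supp u v k → q r ≤ x r k × x r k ≤ suc (q r)
    in-window r k (inj₁ p) = window u (x r) (q r) (near-u r) (q-lower r) (q-upper r) k p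
    in-window r k (inj₂ p) = window v (x r) (q r) (near-v r)
      (subst₂ (λ d s → d * q r ≤ s) deg (sums r) (q-lower r))
      (subst₂ (λ d s → s < d * suc (q r)) deg (sums r) (q-upper r)) k p

    b : Fin 3 → Fin n → ℕ
    b r k = x r k ∸ q r

    b≤1 : ∀ r k → Supp u v k → b r k ≤ 1
    b≤1 r k p = ≤-trans (∸-monoˡ-≤ (q r) (proj₂ (in-window r k p))) (≤-reflexive (m+n∸n≡m 1 (q r)))

    q+b : ∀ r k → Supp u v k → q r + b r k ≡ x r k
    q+b r k p = m+[n∸m]≡n (proj₁ (in-window r k p))

    -- The column sum is fixed, so every point exceeds the base in the same number of rows.
    rise : ℕ
    rise = total ∸ (q 0F + q 1F + q 2F)

    b-sum : ∀ k → Supp u v k → b 0F k + b 1F k + b 2F k ≡ rise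
    b-sum k p = sym (trans (cong (_∸ (q 0F + q 1F + q 2F)) eq) (m+n∸m≡n (q 0F + q 1F + q 2F) _))
      where
      regroup : ∀ a b c d e f → a + d + (b + e) + (c + f) ≡ a + b + c + (d + e + f)
      regroup = solve-∀
      eq : total ≡ q 0F + q 1F + q 2F + (b 0F k + b 1F k + b 2F k)
      eq = trans (sym (column k)) (trans
        (sym (cong₂ _+_ (cong₂ _+_ (q+b 0F k p) (q+b 1F k p)) (q+b 2F k p)))
        (regroup (q 0F) (q 1F) (q 2F) (b 0F k) (b 1F k) (b 2F k)))

    ι : Fin n → Fin 3
    ι k = peak rise (b 0F k) (b 1F k)

    b-profile : ∀ k → Supp u v k → ∀ r → b r k ≡ profile rise (ι k) r
    b-profile k p r = trans (sym (triple-η (λ r → b r k) r))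
      (profile-bits (b≤1 0F k p) (b≤1 1F k p) (b≤1 2F k p) (b-sum k p) r)

    b-dot : ∀ r → dot u (b r) ≡ dot v (b r)
    b-dot r = +-cancelˡ-≡ (sum u * q r) _ _ (begin
      sum u * q r + dot u (b r)       ≡⟨ cong (_+ dot u (b r)) (sym (dot-const u (q r))) ⟩
      dot u (λ _ → q r) + dot u (b r) ≡⟨ sym (dot-+ u (λ _ → q r) (b r)) ⟩
      dot u (λ k → q r + b r k)       ≡⟨ dot-cong u (λ k p → q+b r k (inj₁ p)) ⟩
      dot u (x r)                     ≡⟨ sums r ⟩
      dot v (x r)                     ≡⟨ dot-cong v (λ k p → sym (q+b r k (inj₂ p))) ⟩
      dot v (λ k → q r + b r k)       ≡⟨ dot-+ v (λ _ → q r) (b r) ⟩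
      dot v (λ _ → q r) + dot v (b r) ≡⟨ cong (_+ dot v (b r)) (dot-const v (q r)) ⟩
      sum v * q r + dot v (b r)       ≡⟨ cong (λ d → d * q r + dot v (b r)) (sym deg) ⟩
      sum u * q r + dot v (b r)       ∎)
      where open ≡-Reasoning

    const-dot : ∀ c → dot u (λ _ → c) ≡ dot v (λ _ → c)
    const-dot c = trans (dot-const u c) (trans (cong (_* c) deg) (sym (dot-const v c)))

    profile-dot : ∀ i → dot u (λ k → profile rise (ι k) i) ≡ dot v (λ k → profile rise (ι k) i)
    profile-dot i = trans (dot-cong u (λ k p → sym (b-profile k (inj₁ p) i)))
      (trans (b-dot i) (dot-cong v (λ k p → b-profile k (inj₂ p) i)))

  spikes : Spikes u v x
  spikes = record
    { base    = q
    ; kind    = rise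
    ; index   = ι
    ; shape   = λ k p r → trans (sym (q+b r k p)) (cong (q r +_) (b-profile k p r))
    ; spiky   = λ {k} {k′} → spiky rise (λ r → b r k) (λ r → b r k′)
    ; balance = balance rise (λ k → b 0F k) (λ k → b 1F k) profile-dot
    }
    where
    spiky : ∀ t (y y′ : Fin 3 → ℕ) → peak t (y 0F) (y 1F) ≢ peak t (y′ 0F) (y′ 1F) →
      ∃ λ s → ∀ i r → profile t i r ≡ spike s i r
    spiky 0                   y y′ ne = contradiction refl ne
    spiky 1                   y y′ ne = true , λ i r → refl
    spiky 2                   y y′ ne = false , λ i r → refl
    spiky (suc (suc (suc t))) y y′ ne = contradiction refl ne
    balance : ∀ t (y y′ : Fin n → ℕ) →
      (∀ i → dot u (λ k → profile t (peak t (y k) (y′ k)) i) ≡ dot v (λ k → profile t (peak t (y k) (y′ k)) i)) →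
      ∀ i → dot u (λ k → indicator (peak t (y k) (y′ k)) i) ≡ dot v (λ k → indicator (peak t (y k) (y′ k)) i)
    balance 0 y y′ h i = const-dot (indicator 0F i)
    balance 1 y y′ h i = h i
    -- The exceptional row now carries the single 0, so the indicator is the complement of the
    -- profile, and equality of degrees converts one into the other.
    balance 2 y y′ h i = +-cancelʳ-≡ (dot v g) _ _ (begin
      dot u f + dot v g         ≡⟨ cong (dot u f +_) (sym (h i)) ⟩
      dot u f + dot u g         ≡⟨ sym (dot-+ u f g) ⟩
      dot u (λ k → f k + g k)   ≡⟨ dot-cong u (λ k _ → indicator-complement (firstZero (y k) (y′ k)) i) ⟩
      dot u (λ _ → 1)           ≡⟨ const-dot 1 ⟩
      dot v (λ _ → 1)           ≡⟨ dot-cong v (λ k _ → sym (indicator-complement (firstZero (y k) (y′ k)) i)) ⟩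
      dot v (λ k → f k + g k)   ≡⟨ dot-+ v f g ⟩
      dot v f + dot v g         ∎)
      where
      open ≡-Reasoning
      f g : Fin n → ℕ
      f k = indicator (firstZero (y k) (y′ k)) i
      g k = spike false (firstZero (y k) (y′ k)) i
    balance (suc (suc (suc t))) y y′ h i = const-dot (indicator 0F i)

-- Rounding lowers the energy of an unbalanced pair

value-cong : ∀ {m m′ : Table} → (∀ i j → m i j ≡ m′ i j) → ∀ f → value f m ≡ value f m′
value-cong eq (entry (i , j)) = eq i j
value-cong eq diagonal        = cong₂ _+_ (eq 0F 0F) (eq 1F 1F)

sumOver-cong : ∀ {A : Set} (xs : List A) {f g : A → ℕ} → (∀ x → f x ≡ g x) → sumOver xs f ≡ sumOver xs g
sumOver-cong []       h = refl
sumOver-cong (x ∷ xs) h = cong₂ _+_ (h x) (sumOver-cong xs h)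

weight-cong : ∀ m m′ → (∀ i j → m i j ≡ m′ i j) → weight m ≡ weight m′
weight-cong m m′ eq = sumOver-cong forms λ { (c , f) → cong (λ x → c * sq x) (value-cong {m} {m′} eq f) }

energy-cong : ∀ m n m′ n′ → (∀ f → ∣ value f m - value f n ∣ ≡ ∣ value f m′ - value f n′ ∣) →
  energy m n ≡ energy m′ n′
energy-cong m n m′ n′ eq = sumOver-cong forms λ { (c , f) → cong (λ x → c * sq x) (eq f) }

sq-mono : ∀ {a b} → a ≤ b → sq a ≤ sq b
sq-mono p = *-mono-≤ p p

heavy : ∀ i j → j ≢ 2F → (5 , entry (i , j)) ∈ map (map₂ entry) coefficients
heavy i  2F j≢2 = contradiction refl j≢2
heavy 0F 0F _ = here refl
heavy 0F 1F _ = there (here refl)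
heavy 1F 0F _ = there (there (here refl))
heavy 1F 1F _ = there (there (there (here refl)))
heavy 2F 0F _ = there (there (there (there (here refl))))
heavy 2F 1F _ = there (there (there (there (there (here refl)))))

-- An unbalanced entry gains at least 5 (2² - 1²) = 15, and the diagonal term costs at most 3 · 2² = 12.
rounding-gains : ∀ {R C m n} (ρ : Rounding R C m n) → let open Rounding ρ in
  ∀ i j → j ≢ 2F → 2 ≤ ∣ m i j - n i j ∣ → energy up down < energy m n
rounding-gains {m = m} {n} ρ i j j≢2 far = begin-strict
  energy up down                  ≤⟨ +-monoˡ-≤ rest′ (*-monoʳ-≤ 3 (sq-mono diagonal-near)) ⟩
  12 + rest′                      <⟨ +-monoˡ-< rest′ (from-yes (12 <? 15)) ⟩
  15 + rest′                      ≤⟨ sumOver-gain entries 15 smaller (heavy i j j≢2) gain ⟩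
  sumOver entries (squareDiff m n) ≤⟨ m≤n+m _ (3 * sq ∣ value diagonal m - value diagonal n ∣) ⟩
  energy m n                      ∎
  where
  open Rounding ρ
  open ≤-Reasoning
  entries : List (ℕ × Form)
  entries = map (map₂ entry) coefficients
  rest′ : ℕ
  rest′ = sumOver entries (squareDiff up down)
  diagonal-near : ∣ value diagonal up - value diagonal down ∣ ≤ 2
  diagonal-near = begin
    ∣ u₁ + u₂ - d₁ + d₂ ∣                       ≤⟨ ∣-∣-triangle (u₁ + u₂) (u₁ + d₂) (d₁ + d₂) ⟩
    ∣ u₁ + u₂ - u₁ + d₂ ∣ + ∣ u₁ + d₂ - d₁ + d₂ ∣ ≡⟨ cong₂ _+_ (∣m+n-m+o∣≡∣n-o∣ u₁ u₂ d₂)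
      (trans (cong₂ ∣_-_∣ (+-comm u₁ d₂) (+-comm d₁ d₂)) (∣m+n-m+o∣≡∣n-o∣ d₂ u₁ d₁)) ⟩
    ∣ u₂ - d₂ ∣ + ∣ u₁ - d₁ ∣                   ≤⟨ +-mono-≤ (near 1F 1F) (near 0F 0F) ⟩
    2                                           ∎
    where
    u₁ u₂ d₁ d₂ : ℕ
    u₁ = up 0F 0F
    u₂ = up 1F 1F
    d₁ = down 0F 0F
    d₂ = down 1F 1F
  -- Being within one of each other is not enough where the two points agree; there `fixes` keeps
  -- the rounded entries equal as well.
  entry-smaller : ∀ i j → ∣ up i j - down i j ∣ ≤ ∣ m i j - n i j ∣
  entry-smaller i j with ∣ m i j - n i j ∣ in eq
  ... | zero  = ≤-reflexive (m≡n⇒∣m-n∣≡0 (fixes i j (∣m-n∣≡0⇒m≡n eq)))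
  ... | suc _ = ≤-trans (near i j) (s≤s z≤n)
  smaller : ∀ {x} → x ∈ entries → squareDiff up down x ≤ squareDiff m n x
  smaller p with ∈-map⁻ (map₂ entry) p
  ... | (c , i , j) , _ , refl = *-monoʳ-≤ c (sq-mono (entry-smaller i j))
  gain : 15 + 5 * sq ∣ up i j - down i j ∣ ≤ 5 * sq ∣ m i j - n i j ∣
  gain = begin
    15 + 5 * sq ∣ up i j - down i j ∣ ≤⟨ +-monoʳ-≤ 15 (*-monoʳ-≤ 5 (sq-mono (near i j))) ⟩
    20                                ≤⟨ *-monoʳ-≤ 5 (sq-mono far) ⟩
    5 * sq ∣ m i j - n i j ∣          ∎

-- From lattice points to cells

-- An entry of the last column is what the others leave of the row sum, so its change is the
-- negative of theirs.
third-difference : ∀ o y o′ y′ {s} → o + y ≡ s → o′ + y′ ≡ s → ∣ y - y′ ∣ ≡ ∣ o - o′ ∣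
third-difference o y o′ y′ refl eq = begin
  ∣ y - y′ ∣                   ≡⟨ sym (∣m+n-m+o∣≡∣n-o∣ (o + o′) y y′) ⟩
  ∣ o + o′ + y - o + o′ + y′ ∣ ≡⟨ cong₂ ∣_-_∣ (left o o′ y) (trans (+-assoc o o′ y′) (trans (cong (o +_) eq) (right o y))) ⟩
  ∣ o + y + o′ - o + y + o ∣   ≡⟨ ∣m+n-m+o∣≡∣n-o∣ (o + y) o′ o ⟩
  ∣ o′ - o ∣                   ≡⟨ ∣-∣-comm o′ o ⟩
  ∣ o - o′ ∣                   ∎
  where
  open ≡-Reasoning
  left : ∀ a b c → a + b + c ≡ a + c + b
  left = solve-∀
  right : ∀ a c → a + (a + c) ≡ a + c + a
  right = solve-∀

module Lift (R : Fin 3 → ℕ) (base₀ base₁ : Fin 3 → ℕ) where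

  -- The first two columns of `m` are those of the cell, translated; the last column enters with the
  -- opposite sign. Neither the translation nor the sign affects the energy of a difference.
  record _lifts_ (m c : Table) : Set where
    field
      first  : ∀ r → m r 0F ≡ base₀ r + c r 0F
      second : ∀ r → m r 1F ≡ base₁ r + c r 1F
      third  : ∀ r → base₀ r + base₁ r + c r 2F + m r 2F ≡ R r

  lift : ∀ {m s t i j} → (∀ r → m r 0F + m r 1F + m r 2F ≡ R r) →
    (∀ r → m r 0F ≡ base₀ r + spike s i r) → (∀ r → m r 1F ≡ base₁ r + spike t j r) →
    m lifts cell s t i j
  lift {m} {s} {t} {i} {j} row p q = record
    { first  = p
    ; second = q
    ; third  = λ r → trans (cong (_+ m r 2F) (trans (regroup (base₀ r) (base₁ r) (spike s i r) (spike t j r))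
                 (sym (cong₂ _+_ (p r) (q r))))) (row r)
    }
    where
    regroup : ∀ a b c d → a + b + (c + d) ≡ a + c + (b + d)
    regroup = solve-∀

  lifts-energy : ∀ {m n c d} → m lifts c → n lifts d → energy m n ≡ energy c d
  lifts-energy {m} {n} {c} {d} mc nd = energy-cong m n c d λ where
      (entry (r , 0F)) → trans (cong₂ ∣_-_∣ (M.first r) (N.first r)) (∣m+n-m+o∣≡∣n-o∣ (base₀ r) _ _)
      (entry (r , 1F)) → trans (cong₂ ∣_-_∣ (M.second r) (N.second r)) (∣m+n-m+o∣≡∣n-o∣ (base₁ r) _ _)
      (entry (r , 2F)) → trans (third-difference (base₀ r + base₁ r + c r 2F) (m r 2F)
                                                 (base₀ r + base₁ r + d r 2F) (n r 2F) (M.third r) (N.third r))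
                           (∣m+n-m+o∣≡∣n-o∣ (base₀ r + base₁ r) (c r 2F) (d r 2F))
      diagonal → trans (cong₂ ∣_-_∣ (diag c (M.first 0F) (M.second 1F)) (diag d (N.first 0F) (N.second 1F)))
                   (∣m+n-m+o∣≡∣n-o∣ (base₀ 0F + base₁ 1F) (value diagonal c) (value diagonal d))
    where
    module M = _lifts_ mc
    module N = _lifts_ nd
    regroup : ∀ a b c d → a + b + (c + d) ≡ a + c + (b + d)
    regroup = solve-∀
    diag : ∀ c {x y} → x ≡ base₀ 0F + c 0F 0F → y ≡ base₁ 1F + c 1F 1F →
      x + y ≡ base₀ 0F + base₁ 1F + (c 0F 0F + c 1F 1F)
    diag c p q = trans (cong₂ _+_ p q) (regroup (base₀ 0F) (c 0F 0F) (base₁ 1F) (c 1F 1F))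

-- Standard monomials of a transportation polytope

module Transportation {n : ℕ} (P : Fin n → Table) (R C : Fin 3 → ℕ)
  (lattice-point : ∀ k → HasMargins R C (P k))
  (complete : ∀ m → HasMargins R C m → ∃ λ k → ∀ i j → P k i j ≡ m i j)
  (P-injective : ∀ {k k′} → (∀ i j → P k i j ≡ P k′ i j) → k ≡ k′)
  (R₂<C₂ : R 2F < C 2F) where

  open MonomialOrder (weight ∘ P)

  SameImage : Vec ℕ n → Vec ℕ n → Set
  SameImage u v = sum u ≡ sum v × (∀ i j → dot u (λ k → P k i j) ≡ dot v (λ k → P k i j))

  -- The replacement `pair c d` may be a square, but the divisor `pair a b` may not: this keeps the
  -- generators squarefree. That nothing is lost thereby is part of what `standard-unique` shows.
  Standard : Vec ℕ n → Set
  Standard u = ∀ {a b} → a ≢ b → 1 ≤ lookup u a → 1 ≤ lookup u b →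
    ∀ c d → SameSum (P a) (P b) (P c) (P d) → ¬ (pair c d ≺ pair a b)

  private
    row : ∀ k i → P k i 0F + P k i 1F + P k i 2F ≡ R i
    row k = HasMargins.row (lattice-point k)

    col : ∀ k j → P k 0F j + P k 1F j + P k 2F j ≡ C j
    col k = HasMargins.col (lattice-point k)

    third-column : ∀ {a b c d i} (k k′ : Fin n) → a + b + P k i 2F ≡ R i → c + d + P k′ i 2F ≡ R i →
      a ≡ c → b ≡ d → P k i 2F ≡ P k′ i 2F
    third-column {a} {b} k k′ p q refl refl = +-cancelˡ-≡ (a + b) _ _ (trans p (sym q))

    same-third : ∀ {x y z t x′ y′ z′ t′ r s r′ s′ : ℕ} →
      x + y + r ≡ x′ + y′ + r′ → z + t + s ≡ z′ + t′ + s′ →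
      x + z ≡ x′ + z′ → y + t ≡ y′ + t′ → r + s ≡ r′ + s′
    same-third {x} {y} {z} {t} {x′} {y′} {z′} {t′} {r} {s} {r′} {s′} p q e f =
      +-cancelˡ-≡ (x + z + (y + t)) _ _ (begin
        x + z + (y + t) + (r + s)         ≡⟨ regroup x z y t r s ⟩
        x + y + r + (z + t + s)           ≡⟨ cong₂ _+_ p q ⟩
        x′ + y′ + r′ + (z′ + t′ + s′)     ≡⟨ sym (regroup x′ z′ y′ t′ r′ s′) ⟩
        x′ + z′ + (y′ + t′) + (r′ + s′)   ≡⟨ cong₂ (λ a b → a + b + (r′ + s′)) (sym e) (sym f) ⟩
        x + z + (y + t) + (r′ + s′)       ∎)
      where
      open ≡-Reasoning
      regroup : ∀ x z y t r s → x + z + (y + t) + (r + s) ≡ x + y + r + (z + t + s)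
      regroup = solve-∀

  -- By `complete`, every table with the right margins is one of the points, so improvements may be
  -- built as tables.
  no-improvement : ∀ {u} → Standard u → ∀ {a b} → a ≢ b → 1 ≤ lookup u a → 1 ≤ lookup u b →
    ∀ {m m′} → HasMargins R C m → HasMargins R C m′ → SameSum (P a) (P b) m m′ →
    ¬ (energy m m′ < energy (P a) (P b))
  no-improvement su {a} {b} a≢b pa pb {m} {m′} mm mm′ eq lt =
    let c , Pc = complete m mm
        d , Pd = complete m′ mm′
    in su a≢b pa pb c d (λ i j → trans (eq i j) (sym (cong₂ _+_ (Pc i j) (Pd i j))))
         (lighter⇒≺ (subst₂ _<_ (sym (trans (dot-pair c d (weight ∘ P))
                                       (cong₂ _+_ (weight-cong (P c) m Pc) (weight-cong (P d) m′ Pd))))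
                                 (sym (dot-pair a b (weight ∘ P)))
                                 (energy⇒weight (P a) (P b) m m′ eq lt)))

  balanced : ∀ {u} → Standard u → ∀ {j} → j ≢ 2F → ∀ i a b → 1 ≤ lookup u a → 1 ≤ lookup u b →
    ∣ P a i j - P b i j ∣ ≤ 1
  balanced {u} su {j} j≢2 i a b pa pb with a Fin.≟ b
  ... | yes refl = ≤-trans (≤-reflexive (∣n-n∣≡0 (P a i j))) z≤n
  ... | no a≢b = ≮⇒≥ λ far → no-improvement {u} su a≢b pa pb (up-margins ρ) (down-margins ρ) (same-sum ρ)
                   (rounding-gains ρ i j j≢2 far)
    where
    open Rounding
    ρ : Rounding R C (P a) (P b)
    ρ = rounding (lattice-point a) (lattice-point b)

  mix : Fin n → Fin n → Table
  mix k k′ r 0F = P k r 0F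
  mix k k′ r 1F = P k′ r 1F
  mix k k′ r 2F = R r ∸ (P k r 0F + P k′ r 1F)

  -- `fits` makes the truncated subtraction in `mix` exact; the last column then has the right sum
  -- because the grand total is unchanged.
  mix-margins : ∀ {k k′} → (∀ r → P k r 0F + P k′ r 1F ≤ R r) → HasMargins R C (mix k k′)
  mix-margins {k} {k′} fits = margins mix-row λ where
      0F → col k 0F
      1F → col k′ 1F
      2F → +-cancelˡ-≡ (C 0F + C 1F) _ _ (begin
        C 0F + C 1F + (z 0F + z 1F + z 2F)
          ≡⟨ cong (_+ (z 0F + z 1F + z 2F)) (sym (cong₂ _+_ (col k 0F) (col k′ 1F))) ⟩
        x 0F + x 1F + x 2F + (y 0F + y 1F + y 2F) + (z 0F + z 1F + z 2F)
          ≡⟨ regroup (x 0F) (x 1F) (x 2F) (y 0F) (y 1F) (y 2F) (z 0F) (z 1F) (z 2F) ⟩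
        x 0F + y 0F + z 0F + (x 1F + y 1F + z 1F) + (x 2F + y 2F + z 2F)
          ≡⟨ cong₂ _+_ (cong₂ _+_ (same-row 0F) (same-row 1F)) (same-row 2F) ⟩
        x 0F + P k 0F 1F + P k 0F 2F + (x 1F + P k 1F 1F + P k 1F 2F) + (x 2F + P k 2F 1F + P k 2F 2F)
          ≡⟨ sym (regroup (x 0F) (x 1F) (x 2F) (P k 0F 1F) (P k 1F 1F) (P k 2F 1F) (P k 0F 2F) (P k 1F 2F) (P k 2F 2F)) ⟩
        x 0F + x 1F + x 2F + (P k 0F 1F + P k 1F 1F + P k 2F 1F) + (P k 0F 2F + P k 1F 2F + P k 2F 2F)
          ≡⟨ cong₂ _+_ (cong₂ _+_ (col k 0F) (col k 1F)) (col k 2F) ⟩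
        C 0F + C 1F + C 2F ∎)
    where
    open ≡-Reasoning
    x y z : Fin 3 → ℕ
    x r = P k r 0F
    y r = P k′ r 1F
    z r = mix k k′ r 2F
    mix-row : ∀ r → x r + y r + z r ≡ R r
    mix-row r = m+[n∸m]≡n (fits r)
    same-row : ∀ r → x r + y r + z r ≡ P k r 0F + P k r 1F + P k r 2F
    same-row r = trans (mix-row r) (sym (row k r))
    regroup : ∀ a b c d e f g h i → a + b + c + (d + e + f) + (g + h + i) ≡ a + d + g + (b + e + h) + (c + f + i)
    regroup = solve-∀

  mix-sum : ∀ {k k′} → (∀ r → P k r 0F + P k′ r 1F ≤ R r) → (∀ r → P k′ r 0F + P k r 1F ≤ R r) →
    SameSum (P k) (P k′) (mix k k′) (mix k′ k)
  mix-sum f g i 0F = refl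
  mix-sum {k} {k′} f g i 1F = +-comm (P k i 1F) (P k′ i 1F)
  mix-sum {k} {k′} f g i 2F = same-third {P k i 0F} {P k i 1F} {P k′ i 0F} {P k′ i 1F} {P k i 0F} {P k′ i 1F} {P k′ i 0F} {P k i 1F}
    (trans (row k i) (sym (m+[n∸m]≡n (f i)))) (trans (row k′ i) (sym (m+[n∸m]≡n (g i)))) refl (+-comm (P k i 1F) (P k′ i 1F))

  -- The last row alone cannot hold the whole last column. This is where `R₂<C₂` enters.
  third-column-positive : ∀ k → 1 ≤ P k 0F 2F + P k 1F 2F
  third-column-positive k = +-cancelʳ-< (P k 2F 2F) 0 _ (begin-strict
    P k 2F 2F                         ≤⟨ m≤n+m (P k 2F 2F) _ ⟩
    P k 2F 0F + P k 2F 1F + P k 2F 2F ≡⟨ row k 2F ⟩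
    R 2F                              <⟨ R₂<C₂ ⟩
    C 2F                              ≡⟨ sym (col k 2F) ⟩
    P k 0F 2F + P k 1F 2F + P k 2F 2F ∎)
    where open ≤-Reasoning

  private
    module Compare {u v : Vec ℕ n} (su : Standard u) (sv : Standard v)
      (same : SameImage u v) (0<deg : 0 < sum u) where

      column : ∀ j → j ≢ 2F → Spikes u v (λ r k → P k r j)
      column j j≢2 = spikes u v (proj₁ same) 0<deg (λ r k → P k r j) (λ r → proj₂ same r j)
        (C j) (λ k → col k j) (balanced {u} su j≢2) (balanced {v} sv j≢2)

      module S₀ = Spikes (column 0F λ ())
      module S₁ = Spikes (column 1F λ ())

      ι κ : Fin n → Fin 3
      ι = S₀.index
      κ = S₁.index

      ι-determines : ∀ {k k′} → Supp u v k → Supp u v k′ → ι k ≡ ι k′ → ∀ r → P k r 0F ≡ P k′ r 0F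
      ι-determines {k} {k′} p p′ e r = trans (S₀.shape k p r)
        (trans (cong (λ i → S₀.base r + profile S₀.kind i r) e) (sym (S₀.shape k′ p′ r)))

      κ-determines : ∀ {k k′} → Supp u v k → Supp u v k′ → κ k ≡ κ k′ → ∀ r → P k r 1F ≡ P k′ r 1F
      κ-determines {k} {k′} p p′ e r = trans (S₁.shape k p r)
        (trans (cong (λ i → S₁.base r + profile S₁.kind i r) e) (sym (S₁.shape k′ p′ r)))

      in-u : ∀ {k} → lookup v k < lookup u k → 1 ≤ lookup u k
      in-u = ≤-trans (s≤s z≤n)

      in-v : ∀ {k} → lookup u k < lookup v k → 1 ≤ lookup v k
      in-v = ≤-trans (s≤s z≤n)

      joint : ∀ {k k′} → lookup v k < lookup u k → lookup u k′ < lookup v k′ → ι k ≡ ι k′ → κ k ≡ κ k′ → ⊥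
      joint {k} {k′} p p′ e f = <-asym p (subst (λ k → lookup u k < lookup v k) (sym k≡k′) p′)
        where
        first = ι-determines (inj₁ (in-u p)) (inj₂ (in-v p′)) e
        second = κ-determines (inj₁ (in-u p)) (inj₂ (in-v p′)) f
        k≡k′ : k ≡ k′
        k≡k′ = P-injective λ where
          i 0F → first i
          i 1F → second i
          i 2F → third-column k k′ (row k i) (row k′ i) (first i) (second i)

      -- The term order is total: the larger of the two products contradicts the standardness of its
      -- own monomial, and equal products would give one point a surplus on both sides.
      no-4-cycle : ∀ {k₁ k₂ k₃ k₄} → lookup v k₁ < lookup u k₁ → lookup u k₂ < lookup v k₂ →
        lookup v k₃ < lookup u k₃ → lookup u k₄ < lookup v k₄ →
        ι k₁ ≡ ι k₂ → κ k₂ ≡ κ k₃ → ι k₃ ≡ ι k₄ → κ k₄ ≡ κ k₁ → ⊥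
      no-4-cycle {k₁} {k₂} {k₃} {k₄} p₁ p₂ p₃ p₄ ι₁₂ κ₂₃ ι₃₄ κ₄₁ =
        case ≺-compare (pair k₁ k₃) (pair k₂ k₄) of λ where
          (tri< lt _ _) → sv k₂≢k₄ (in-v p₂) (in-v p₄) k₁ k₃ (λ i j → sym (exchanged i j)) lt
          (tri> _ _ gt) → su k₁≢k₃ (in-u p₁) (in-u p₃) k₂ k₄ exchanged gt
          (tri≈ _ eq _) → case pair-injective {a = k₁} {b = k₃} eq of λ where
            (inj₁ refl) → <-asym p₁ p₂
            (inj₂ refl) → <-asym p₁ p₄
        where
        k₁≢k₃ : k₁ ≢ k₃
        k₁≢k₃ refl = joint p₁ p₂ ι₁₂ (sym κ₂₃)
        k₂≢k₄ : k₂ ≢ k₄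
        k₂≢k₄ refl = joint p₁ p₂ ι₁₂ (sym κ₄₁)
        first : ∀ i → P k₁ i 0F + P k₃ i 0F ≡ P k₂ i 0F + P k₄ i 0F
        first i = cong₂ _+_ (ι-determines (inj₁ (in-u p₁)) (inj₂ (in-v p₂)) ι₁₂ i)
                            (ι-determines (inj₁ (in-u p₃)) (inj₂ (in-v p₄)) ι₃₄ i)
        second : ∀ i → P k₁ i 1F + P k₃ i 1F ≡ P k₂ i 1F + P k₄ i 1F
        second i = trans (+-comm (P k₁ i 1F) _)
          (cong₂ _+_ (κ-determines (inj₁ (in-u p₃)) (inj₂ (in-v p₂)) (sym κ₂₃) i)
                     (κ-determines (inj₁ (in-u p₁)) (inj₂ (in-v p₄)) (sym κ₄₁) i))
        exchanged : SameSum (P k₁) (P k₃) (P k₂) (P k₄)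
        exchanged i 0F = first i
        exchanged i 1F = second i
        exchanged i 2F = same-third {P k₁ i 0F} {P k₁ i 1F} {P k₃ i 0F} {P k₃ i 1F} {P k₂ i 0F} {P k₂ i 1F} {P k₄ i 0F} {P k₄ i 1F}
          (trans (row k₁ i) (sym (row k₂ i))) (trans (row k₃ i) (sym (row k₄ i))) (first i) (second i)

      no-6-cycle : ∀ {k₁ k₂ k₃ k₄ k₅ k₆} →
        lookup v k₁ < lookup u k₁ → lookup u k₂ < lookup v k₂ → lookup v k₃ < lookup u k₃ →
        lookup u k₄ < lookup v k₄ → lookup v k₅ < lookup u k₅ → lookup u k₆ < lookup v k₆ →
        ι k₁ ≡ ι k₂ → κ k₂ ≡ κ k₃ → ι k₃ ≡ ι k₄ → κ k₄ ≡ κ k₅ → ι k₅ ≡ ι k₆ → κ k₆ ≡ κ k₁ →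
        ι k₁ ≢ ι k₃ → ι k₃ ≢ ι k₅ → ι k₅ ≢ ι k₁ →
        κ k₁ ≢ κ k₃ → κ k₃ ≢ κ k₅ → κ k₅ ≢ κ k₁ → ⊥
      no-6-cycle {k₁} {k₂} {k₃} {k₄} {k₅} {k₆} p₁ p₂ p₃ p₄ p₅ p₆ ι₁₂ κ₂₃ ι₃₄ κ₄₅ ι₅₆ κ₆₁
        ι₁≢ι₃ ι₃≢ι₅ ι₅≢ι₁ κ₁≢κ₃ κ₃≢κ₅ κ₅≢κ₁ =
        case verdicts s t (ι k₁) (ι k₃) (ι k₅) ι₁≢ι₃ ι₃≢ι₅ ι₅≢ι₁
                          (κ k₁) (κ k₃) (κ k₅) κ₁≢κ₃ κ₃≢κ₅ κ₅≢κ₁ of λ where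
          (inj₁ ref) → refute reach reach-fits ref
          (inj₂ (ref₀ , ref₁ , inj₁ (x , tight))) → refute-tight ref₀ ref₁ true x tight
          (inj₂ (ref₀ , ref₁ , inj₂ (x , tight))) → refute-tight ref₀ ref₁ false x tight
        where
        -- Two different indices rule out constant columns, so both columns are spikes with a
        -- definite direction.
        s t : Bool
        s = proj₁ (S₀.spiky ι₁≢ι₃)
        t = proj₁ (S₁.spiky κ₁≢κ₃)
        α β : Fin 3 → Fin 3
        α = triple (ι k₁) (ι k₃) (ι k₅)
        β = triple (κ k₁) (κ k₃) (κ k₅)
        open Hexagon s t α β
        open Lift R S₀.base S₁.base

        monomial : Bool → Vec ℕ n
        monomial side = if side then u else v
        standard : ∀ side → Standard (monomial side)
        standard true  = su
        standard false = sv
        point : Bool → Fin 3 → Fin n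
        point true  = triple k₁ k₃ k₅
        point false = triple k₂ k₄ k₆
        ι-point : ∀ side x → ι (point side x) ≡ α x
        ι-point true  0F = refl
        ι-point true  1F = refl
        ι-point true  2F = refl
        ι-point false 0F = sym ι₁₂
        ι-point false 1F = sym ι₃₄
        ι-point false 2F = sym ι₅₆
        κ-point : ∀ side x → κ (point side x) ≡ β (partner side x)
        κ-point true  0F = refl
        κ-point true  1F = refl
        κ-point true  2F = refl
        κ-point false 0F = κ₂₃
        κ-point false 1F = κ₄₅
        κ-point false 2F = κ₆₁
        in-monomial : ∀ side x → 1 ≤ lookup (monomial side) (point side x)
        in-monomial true  0F = in-u p₁
        in-monomial true  1F = in-u p₃
        in-monomial true  2F = in-u p₅
        in-monomial false 0F = in-v p₂
        in-monomial false 1F = in-v p₄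
        in-monomial false 2F = in-v p₆
        supp : ∀ side x → Supp u v (point side x)
        supp true  x = inj₁ (in-monomial true x)
        supp false x = inj₂ (in-monomial false x)
        α-next : ∀ x → α x ≢ α (next x)
        α-next 0F = ι₁≢ι₃
        α-next 1F = ι₃≢ι₅
        α-next 2F = ι₅≢ι₁
        point-next : ∀ side x → point side x ≢ point side (next x)
        point-next side x e = α-next x (trans (sym (ι-point side x)) (trans (cong ι e) (ι-point side (next x))))

        first : ∀ side x r → P (point side x) r 0F ≡ S₀.base r + spike s (α x) r
        first side x r = trans (S₀.shape (point side x) (supp side x) r) (cong (S₀.base r +_)
          (trans (proj₂ (S₀.spiky ι₁≢ι₃) (ι (point side x)) r) (cong (λ i → spike s i r) (ι-point side x))))
        second : ∀ side x r → P (point side x) r 1F ≡ S₁.base r + spike t (β (partner side x)) r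
        second side x r = trans (S₁.shape (point side x) (supp side x) r) (cong (S₁.base r +_)
          (trans (proj₂ (S₁.spiky κ₁≢κ₃) (κ (point side x)) r) (cong (λ i → spike t i r) (κ-point side x))))
        lifts-vertex : ∀ side x → P (point side x) lifts vertex side x
        lifts-vertex side x = lift {i = α x} {β (partner side x)} (row (point side x)) (first side x) (second side x)

        Fits : (Fin 3 → ℕ) → Set
        Fits bound = ∀ r → S₀.base r + S₁.base r + bound r ≤ R r

        refute : ∀ bound → Fits bound → ¬ Refutable bound
        refute bound fits ref = case ref of λ where
            (inj₁ (x , imp)) → improve true x imp
            (inj₂ (x , imp)) → improve false x imp
          where
          regroup : ∀ a b c d → a + c + (b + d) ≡ a + b + (c + d)
          regroup = solve-∀
          improve : ∀ side x → ¬ Improvable bound side x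
          improve side x (h , h′ , lt) = no-improvement {monomial side} (standard side) (point-next side x)
              (in-monomial side x) (in-monomial side y) mm mm′ (mix-sum {k} {k′} f f′)
              (subst₂ _<_
                (sym (lifts-energy (lift {mix k k′} {i = α x} {β q} (HasMargins.row mm) (first side x) (second side y))
                                   (lift {mix k′ k} {i = α y} {β p} (HasMargins.row mm′) (first side y) (second side x))))
                (sym (lifts-energy (lifts-vertex side x) (lifts-vertex side y))) lt)
            where
            y p q : Fin 3
            y = next x
            p = partner side x
            q = partner side y
            k k′ : Fin n
            k  = point side x
            k′ = point side y
            bounded : ∀ {x′ y′ r} → cell s t (α x′) (β (partner side y′)) r 2F ≤ bound r →
              P (point side x′) r 0F + P (point side y′) r 1F ≤ R r
            bounded {x′} {y′} {r} le = ≤-trans (≤-reflexive (trans (cong₂ _+_ (first side x′ r) (second side y′ r))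
              (regroup (S₀.base r) (S₁.base r) (spike s (α x′) r) (spike t (β (partner side y′)) r))))
              (≤-trans (+-monoʳ-≤ (S₀.base r + S₁.base r) le) (fits r))
            f : ∀ r → P k r 0F + P k′ r 1F ≤ R r
            f r = bounded {x} {y} (h r)
            f′ : ∀ r → P k′ r 0F + P k r 1F ≤ R r
            f′ r = bounded {y} {x} (h′ r)
            mm : HasMargins R C (mix k k′)
            mm = mix-margins f
            mm′ : HasMargins R C (mix k′ k)
            mm′ = mix-margins f′

        reach-fits : Fits reach
        reach-fits r = fits-⊔ (fits-⊔ (fits-⊔ (vertex-fits true 0F) (vertex-fits true 1F)) (vertex-fits true 2F))
                              (fits-⊔ (fits-⊔ (vertex-fits false 0F) (vertex-fits false 1F)) (vertex-fits false 2F))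
          where
          vertex-fits : ∀ side x → S₀.base r + S₁.base r + vertex side x r 2F ≤ R r
          vertex-fits side x = ≤-trans (m≤m+n _ _) (≤-reflexive (_lifts_.third (lifts-vertex side x) r))
          fits-⊔ : ∀ {a b} → S₀.base r + S₁.base r + a ≤ R r → S₀.base r + S₁.base r + b ≤ R r →
            S₀.base r + S₁.base r + (a ⊔ b) ≤ R r
          fits-⊔ {a} {b} p q = subst (_≤ R r) (sym (+-distribˡ-⊔ (S₀.base r + S₁.base r) a b)) (⊔-lub p q)

        -- At a vertex that attains `reach i`, the bases and `reach i` are exactly what the first
        -- two columns use, so a positive last entry is one spare unit.
        raise-fits : ∀ i side x → vertex side x i 2F ≡ reach i → 1 ≤ P (point side x) i 2F → Fits (raise i)
        raise-fits i side x e pos r with i Fin.≟ r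
        ... | no _     = reach-fits r
        ... | yes refl = begin
          S₀.base i + S₁.base i + suc (reach i)                  ≡⟨ cong (λ z → S₀.base i + S₁.base i + z) (+-comm 1 (reach i)) ⟩
          S₀.base i + S₁.base i + (reach i + 1)                  ≡⟨ sym (+-assoc (S₀.base i + S₁.base i) (reach i) 1) ⟩
          S₀.base i + S₁.base i + reach i + 1                    ≡⟨ cong (λ z → S₀.base i + S₁.base i + z + 1) (sym e) ⟩
          S₀.base i + S₁.base i + vertex side x i 2F + 1         ≤⟨ +-monoʳ-≤ _ pos ⟩
          S₀.base i + S₁.base i + vertex side x i 2F + P (point side x) i 2F ≡⟨ _lifts_.third (lifts-vertex side x) i ⟩
          R i                                                    ∎
          where open ≤-Reasoning

        refute-tight : Refutable (raise 0F) → Refutable (raise 1F) → ∀ side x → ¬ Tight side x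
        refute-tight ref₀ ref₁ side x (e₀ , e₁) = case 1 ≤? P (point side x) 0F 2F of λ where
          (yes pos) → refute (raise 0F) (raise-fits 0F side x e₀ pos) ref₀
          (no ¬pos) → refute (raise 1F) (raise-fits 1F side x e₁
            (subst (λ z → 1 ≤ z + P (point side x) 1F 2F) (n<1⇒n≡0 (≰⇒> ¬pos)) (third-column-positive (point side x)))) ref₁

      compare-≤ : ∀ k → lookup u k ≤ lookup v k
      compare-≤ = Tables.tables-≤ (lookup u) (lookup v) ι κ joint S₀.partner S₁.partner′ no-4-cycle no-6-cycle

    null : ∀ {m} (u : Vec ℕ m) → sum u ≡ 0 → u ≡ Vec.replicate m 0
    null []         _ = refl
    null (zero ∷ u) e = cong (0 ∷_) (null u e)

  standard-unique : ∀ {u v} → Standard u → Standard v → SameImage u v → u ≡ v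
  -- Degree zero is set apart because the shape of the columns comes from dividing by the degree.
  standard-unique {u} {v} su sv same = case sum u ≟ 0 of λ where
    (yes e) → trans (null u e) (sym (null v (trans (sym (proj₁ same)) e)))
    (no e)  → trans (sym (tabulate∘lookup u)) (trans (tabulate-cong λ k →
      ≤-antisym (Compare.compare-≤ {u} {v} su sv same (n≢0⇒n>0 e) k)
                (Compare.compare-≤ {v} {u} sv su (sym (proj₁ same) , λ i j → sym (proj₂ same i j))
                  (subst (0 <_) (proj₁ same) (n≢0⇒n>0 e)) k)) (tabulate∘lookup v))

  -- Leading terms and reduction within a fibre

  sameImage-trans : ∀ {u v t} → SameImage u v → SameImage v t → SameImage u t
  sameImage-trans (p , q) (p′ , q′) = trans p p′ , λ i j → trans (q i j) (q′ i j)

  sameImage-⊕ : ∀ {u v} t → SameImage u v → SameImage (u ⊕ t) (v ⊕ t)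
  sameImage-⊕ {u} {v} t (p , q) =
    trans (sum-⊕ u t) (trans (cong (_+ sum t) p) (sym (sum-⊕ v t))) ,
    λ i j → trans (dot-⊕ u t _) (trans (cong (_+ dot t _) (q i j)) (sym (dot-⊕ v t _)))

  sameImage-pair : ∀ {a b c d} → SameSum (P a) (P b) (P c) (P d) → SameImage (pair a b) (pair c d)
  sameImage-pair {a} {b} {c} {d} eq = trans (sum-pair a b) (sym (sum-pair c d)) ,
    λ i j → trans (dot-pair a b _) (trans (eq i j) (sym (dot-pair c d _)))

  Reducible : Fin n × Fin n → Set
  Reducible (a , b) = a ≢ b × ∃ λ c → ∃ λ d → SameSum (P a) (P b) (P c) (P d) × pair c d ≺ pair a b

  reducible? : ∀ x → Dec (Reducible x)
  reducible? (a , b) = ¬? (a Fin.≟ b) ×-dec (Fin.any? λ c → Fin.any? λ d →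
    (Fin.all? λ i → Fin.all? λ j → _ ≟ _) ×-dec (pair c d ≺? pair a b))

  leadingTerms : List (Vec ℕ n)
  leadingTerms = map (λ (a , b) → pair a b)
    (filter reducible? (cartesianProduct (allFin n) (allFin n)))

  leadingTerms-sound : ∀ {g} → g ∈ leadingTerms →
    ∃ λ a → ∃ λ b → g ≡ pair a b × a ≢ b × ∃ λ h → h ≺ g × SameImage g h
  leadingTerms-sound {g} p with ∈-map⁻ _ p
  ... | (a , b) , q , refl with ∈-filter⁻ reducible? {xs = cartesianProduct (allFin n) (allFin n)} q
  ...   | _ , a≢b , c , d , eq , lt = a , b , refl , a≢b , pair c d , lt , sameImage-pair {a} {b} {c} {d} eq

  leadingTerms-complete : ∀ a b → Reducible (a , b) → pair a b ∈ leadingTerms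
  leadingTerms-complete a b red = ∈-map⁺ (λ (a , b) → pair a b)
    (∈-filter⁺ reducible? (∈-cartesianProduct⁺ (∈-allFin a) (∈-allFin b)) red)

  divisible-or-standard : ∀ u → (∃ λ g → ∃ λ t → g ∈ leadingTerms × g ⊕ t ≡ u) ⊎ Standard u
  divisible-or-standard u = case Fin.any? (λ a → Fin.any? λ b →
      (1 ≤? lookup u a) ×-dec ((1 ≤? lookup u b) ×-dec reducible? (a , b))) of λ where
    (yes (a , b , pa , pb , red)) →
      let t , eq = pair-divides {u = u} (proj₁ red) pa pb
      in inj₁ (pair a b , t , leadingTerms-complete a b red , eq)
    (no ∄) → inj₂ λ {a} {b} a≢b pa pb c d eq lt → ∄ (a , b , pa , pb , a≢b , c , d , eq , lt)

  -- From a smaller `v`, keep replacing leading terms by smaller products of the same fibre. By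
  -- well-foundedness this ends at a standard monomial still below `u`, which uniqueness identifies
  -- with `u`.
  standard-minimal : ∀ {u} → Standard u → ∀ v → SameImage u v → ¬ (v ≺ u)
  standard-minimal {u} su v = go v (≺-wellFounded v)
    where
    go : ∀ v → Acc _≺_ v → SameImage u v → ¬ (v ≺ u)
    go v (acc rs) same v≺u with divisible-or-standard v
    ... | inj₂ sv = ≺-irrefl {u} (subst (_≺ u) (sym (standard-unique su sv same)) v≺u)
    ... | inj₁ (g , t , g∈ , refl) =
      let _ , _ , _ , _ , h , h≺g , same′ = leadingTerms-sound g∈
          smaller = ⊕-monoˡ-≺ h g t h≺g
      in go (h ⊕ t) (rs smaller)
           (sameImage-trans {u} {g ⊕ t} {h ⊕ t} same (sameImage-⊕ {g} {h} t same′))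
           (≺-trans {h ⊕ t} {g ⊕ t} {u} smaller v≺u)

-- Initial ideals of kernels of monomial maps

module InitialIdeal {c ℓ : Level} (F : Field c ℓ) {n : ℕ} (image : Vec ℕ n → ℕ × Mat) where

  open Field F using (Carrier; _≈_; 1#; 0#; 1≉0; reflexive) renaming
    (_+_ to _+ᶠ_; _*_ to _*ᶠ_; -_ to -ᶠ_; refl to ≈-refl; sym to ≈-sym; trans to ≈-trans;
     +-cong to +ᶠ-cong; +-assoc to +ᶠ-assoc; +-comm to +ᶠ-comm; +-identity to +ᶠ-identity; -‿inverse to -ᶠ-inverse)
  open Poly F

  imageCoeff : Pol n → TExp → Carrier
  imageCoeff f = coeff _≟T_ (map (map₂ image) f)

  private
    +0 : ∀ x → x +ᶠ 0# ≈ x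
    +0 = proj₂ +ᶠ-identity

    coeff-here : ∀ {E : Set} (_≟ᴱ_ : DecidableEquality E) a {e′ e} p → e′ ≡ e →
      coeff _≟ᴱ_ ((a , e′) ∷ p) e ≡ a +ᶠ coeff _≟ᴱ_ p e
    coeff-here _≟ᴱ_ a {e′} {e} p eq with e′ ≟ᴱ e
    ... | yes _ = refl
    ... | no ne = contradiction eq ne

    coeff-there : ∀ {E : Set} (_≟ᴱ_ : DecidableEquality E) a {e′ e} p → e′ ≢ e →
      coeff _≟ᴱ_ ((a , e′) ∷ p) e ≡ coeff _≟ᴱ_ p e
    coeff-there _≟ᴱ_ a {e′} {e} p ne with e′ ≟ᴱ e
    ... | yes eq = contradiction eq ne
    ... | no _   = refl

    -- A list may contain a monomial several times, so all its terms are removed together.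
    delete : Mono n → Pol n → Pol n
    delete m []            = []
    delete m ((a , u) ∷ f) with u ≟m m
    ... | yes _ = delete m f
    ... | no  _ = (a , u) ∷ delete m f

    delete-length : ∀ m f → length (delete m f) ≤ length f
    delete-length m []            = z≤n
    delete-length m ((a , u) ∷ f) with u ≟m m
    ... | yes _ = m≤n⇒m≤1+n (delete-length m f)
    ... | no  _ = s≤s (delete-length m f)

    coeff-delete-self : ∀ m f → coeffP (delete m f) m ≈ 0#
    coeff-delete-self m []            = ≈-refl
    coeff-delete-self m ((a , u) ∷ f) with u ≟m m
    ... | yes _  = coeff-delete-self m f
    ... | no u≢m with u ≟m m
    ...   | yes u≡m = contradiction u≡m u≢m
    ...   | no _    = coeff-delete-self m f

    coeff-delete : ∀ {m m′} f → m ≢ m′ → coeffP (delete m f) m′ ≈ coeffP f m′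
    coeff-delete []            m≢m′ = ≈-refl
    coeff-delete {m} {m′} ((a , u) ∷ f) m≢m′ with u ≟m m
    coeff-delete {m} {m′} ((a , u) ∷ f) m≢m′ | yes refl with u ≟m m′
    ... | yes u≡m′ = contradiction u≡m′ m≢m′
    ... | no _     = coeff-delete f m≢m′
    coeff-delete {m} {m′} ((a , u) ∷ f) m≢m′ | no _ with u ≟m m′
    ... | yes _ = +ᶠ-cong ≈-refl (coeff-delete f m≢m′)
    ... | no _  = coeff-delete f m≢m′

    imageCoeff-split : ∀ {m e} f → image m ≡ e → imageCoeff f e ≈ coeffP f m +ᶠ imageCoeff (delete m f) e
    imageCoeff-split []                    eq = ≈-sym (+0 0#)
    imageCoeff-split {m} {e} ((a , u) ∷ f) eq with u ≟m m
    imageCoeff-split {m} {e} ((a , u) ∷ f) eq | yes refl with image u ≟T e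
    ... | yes _ = ≈-trans (+ᶠ-cong ≈-refl (imageCoeff-split f eq)) (≈-sym (+ᶠ-assoc a _ _))
    ... | no ≢e = contradiction eq ≢e
    imageCoeff-split {m} {e} ((a , u) ∷ f) eq | no _ with image u ≟T e
    ... | no _  = imageCoeff-split f eq
    ... | yes _ = ≈-trans (+ᶠ-cong ≈-refl (imageCoeff-split f eq)) (≈-trans (≈-sym (+ᶠ-assoc a _ _))
      (≈-trans (+ᶠ-cong (+ᶠ-comm a _) ≈-refl) (+ᶠ-assoc _ a _)))

    imageCoeff-delete : ∀ {m e} f → image m ≢ e → imageCoeff f e ≈ imageCoeff (delete m f) e
    imageCoeff-delete []                    ne = ≈-refl
    imageCoeff-delete {m} {e} ((a , u) ∷ f) ne with u ≟m m
    imageCoeff-delete {m} {e} ((a , u) ∷ f) ne | yes refl with image u ≟T e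
    ... | yes eq = contradiction eq ne
    ... | no _   = imageCoeff-delete f ne
    imageCoeff-delete {m} {e} ((a , u) ∷ f) ne | no _ with image u ≟T e
    ... | no _  = imageCoeff-delete f ne
    ... | yes _ = +ᶠ-cong ≈-refl (imageCoeff-delete f ne)

    -- Zero coefficients do not empty the list, since repeated terms may cancel. The induction
    -- therefore removes every occurrence of the head monomial, and `k` bounds the length that
    -- remains.
    imageCoeff-zero : ∀ k f e → length f ≤ k → (∀ u → image u ≡ e → coeffP f u ≈ 0#) → imageCoeff f e ≈ 0#
    imageCoeff-zero k       []            e _          zeros = ≈-refl
    imageCoeff-zero (suc k) ((a , u) ∷ f) e (s≤s len) zeros = case image u ≟T e of λ where
        (yes eq) → ≈-trans (imageCoeff-split ((a , u) ∷ f) eq)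
                     (≈-trans (+ᶠ-cong (zeros u eq) rest) (+0 0#))
        (no ne)  → ≈-trans (imageCoeff-delete ((a , u) ∷ f) ne) rest
      where
      delete-head : delete u ((a , u) ∷ f) ≡ delete u f
      delete-head with u ≟m u
      ... | yes _ = refl
      ... | no ne = contradiction refl ne
      zeros′ : ∀ v → image v ≡ e → coeffP (delete u ((a , u) ∷ f)) v ≈ 0#
      zeros′ v eq with u ≟m v
      ... | yes refl = coeff-delete-self u ((a , u) ∷ f)
      ... | no u≢v   = ≈-trans (coeff-delete ((a , u) ∷ f) u≢v) (zeros v eq)
      rest : imageCoeff (delete u ((a , u) ∷ f)) e ≈ 0#
      rest = subst (λ g → imageCoeff g e ≈ 0#) (sym delete-head)
        (imageCoeff-zero k (delete u f) e (≤-trans (delete-length u f) len)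
          (λ v eq → subst (λ g → coeffP g v ≈ 0#) delete-head (zeros′ v eq)))

    shift : Mono n → Pol n → Pol n
    shift t = map (map₂ (_⊕ t))

    -- The surplus factor `t` of a multiple of a generator moves into the cofactor. As the two lists
    -- are identical, a combination can be rewritten without comparing coefficients.
    shift-* : ∀ h t g → shift t h *P monoP g ≡ h *P monoP (g ⊕ t)
    shift-* []            t g = refl
    shift-* ((a , u) ∷ h) t g = cong₂ (λ m rest → (a *ᶠ 1# , m) ∷ rest)
      (trans (⊕-assoc u t g) (cong (u ⊕_) (⊕-comm t g))) (shift-* h t g)

  module _ (w : Fin n → ℕ) (I : Pol n → Set ℓ)
    (I-sound : ∀ f → I f → ∀ e → imageCoeff f e ≈ 0#) (I-complete : ∀ f → (∀ e → imageCoeff f e ≈ 0#) → I f) where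

    open MonomialOrder w

    termOrder : TermOrder n
    termOrder = record
      { _≺_      = _≺_
      ; isSTO    = ≺-isStrictTotalOrder
      ; mult     = ⊕-monoˡ-≺
      ; oneLeast = 0-least-≺
      }

    -- In the fibre of `m`, nothing lies below `m` and everything above has coefficient zero. So the
    -- coefficient of the image of `f` at `image m` is the leading coefficient, which cannot vanish.
    not-initial : ∀ {f m} → I f → IsInitMono termOrder f m →
      ¬ (∀ v → image v ≡ image m → ¬ v ≺ m)
    not-initial {f} {m} f∈I (lead≉0 , above) minimal =
      lead≉0 (≈-trans (≈-sym (+0 _)) (≈-trans (+ᶠ-cong ≈-refl (≈-sym others))
        (≈-trans (≈-sym (imageCoeff-split f refl)) (I-sound f f∈I (image m)))))
      where
      zeros : ∀ v → image v ≡ image m → coeffP (delete m f) v ≈ 0#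
      zeros v eq with ≺-compare v m
      ... | tri< v≺m _ _    = contradiction v≺m (minimal v eq)
      ... | tri≈ _ refl _   = coeff-delete-self m f
      ... | tri> _ v≢m m≺v = ≈-trans (coeff-delete f (v≢m ∘ sym)) (above v m≺v)
      others : imageCoeff (delete m f) (image m) ≈ 0#
      others = imageCoeff-zero _ (delete m f) (image m) ≤-refl zeros

    binomial : ∀ {m h} → h ≺ m → image h ≡ image m → InitGen termOrder I (monoP m)
    binomial {m} {h} h≺m same = f , m , I-complete f in-kernel , (lead , above) , refl
      where
      f : Pol n
      f = (1# , m) ∷ (-ᶠ 1# , h) ∷ []
      in-kernel : ∀ e → imageCoeff f e ≈ 0#
      in-kernel e = case image m ≟T e of λ where
        (yes eq) → ≈-trans (reflexive (coeff-here _≟T_ 1# _ eq))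
          (≈-trans (+ᶠ-cong ≈-refl (≈-trans (reflexive (coeff-here _≟T_ (-ᶠ 1#) [] (trans same eq))) (+0 _)))
            (proj₂ -ᶠ-inverse 1#))
        (no ne) → reflexive (trans (coeff-there _≟T_ 1# _ ne)
          (coeff-there _≟T_ (-ᶠ 1#) [] (ne ∘ trans (sym same))))
      lead : ¬ (coeffP f m ≈ 0#)
      lead eq = 1≉0 (≈-trans (≈-sym (≈-trans (reflexive (coeff-here _≟m_ 1# {m} {m} ((-ᶠ 1# , h) ∷ []) refl))
        (≈-trans (+ᶠ-cong ≈-refl (reflexive (coeff-there _≟m_ (-ᶠ 1#) [] h≢m))) (+0 1#)))) eq)
        where
        h≢m : h ≢ m
        h≢m refl = ≺-irrefl {m} h≺m
      above : ∀ m′ → m ≺ m′ → coeffP f m′ ≈ 0#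
      above m′ m≺m′ = reflexive (trans (coeff-there _≟m_ 1# _ m≢m′) (coeff-there _≟m_ (-ᶠ 1#) [] h≢m′))
        where
        m≢m′ : m ≢ m′
        m≢m′ refl = ≺-irrefl {m} m≺m′
        h≢m′ : h ≢ m′
        h≢m′ refl = ≺-irrefl {h} (≺-trans {h} {m} {h} h≺m m≺m′)

    module _ (G : List (Mono n))
      (G-leading : ∀ {g} → g ∈ G → ∃ λ h → h ≺ g × image h ≡ image g)
      (G-complete : ∀ m → (∃ λ g → ∃ λ t → g ∈ G × g ⊕ t ≡ m) ⊎ (∀ v → image v ≡ image m → ¬ v ≺ m)) where

      private
        MonoIn : Pol n → Set c
        MonoIn g = Σ (Mono n) λ m → m ∈ G × g ≡ monoP m

        combination : List (Pol n × Pol n) → Pol n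
        combination = foldr (λ hg acc → (proj₁ hg *P proj₂ hg) +P acc) 0P

        rewrite-generators : ∀ hs → All (λ hg → InitGen termOrder I (proj₂ hg)) hs →
          Σ (List (Pol n × Pol n)) λ hs′ → All (λ hg → MonoIn (proj₂ hg)) hs′ × combination hs′ ≡ combination hs
        rewrite-generators [] [] = [] , [] , refl
        rewrite-generators ((h , _) ∷ hs) ((f , m , f∈I , init , refl) ∷ gens)
          with G-complete m | rewrite-generators hs gens
        ... | inj₂ minimal | _ = contradiction minimal (not-initial {f} f∈I init)
        ... | inj₁ (g , t , g∈G , refl) | hs′ , gens′ , eq =
          (shift t h , monoP g) ∷ hs′ , (g , g∈G , refl) ∷ gens′ , cong₂ _+P_ (shift-* h t g) eq

      initial-ideal : ∀ p →
        ((p ∈⟨ InitGen termOrder I ⟩) → (p ∈⟨ MonoIn ⟩)) ×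
        ((p ∈⟨ MonoIn ⟩) → (p ∈⟨ InitGen termOrder I ⟩))
      initial-ideal p = to , from
        where
        to : (p ∈⟨ InitGen termOrder I ⟩) → (p ∈⟨ MonoIn ⟩)
        to (hs , gens , eq) =
          let hs′ , gens′ , eq′ = rewrite-generators hs gens
          in hs′ , gens′ , subst (p ≈P_) (sym eq′) eq
        from : (p ∈⟨ MonoIn ⟩) → (p ∈⟨ InitGen termOrder I ⟩)
        from (hs , gens , eq) = hs , All.map (λ {hg} → initial {hg}) gens , eq
          where
          initial : ∀ {hg : Pol n × Pol n} → MonoIn (proj₂ hg) → InitGen termOrder I (proj₂ hg)
          initial (m , m∈G , refl) = let h , h≺m , same = G-leading m∈G in binomial {m} {h} h≺m same

-- The list of lattice points is complete and free of repetitions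

-- `key` recovers the block of an element, so blocks are disjoint. A repeated lattice point would
-- give two variables with the same image, hence a linear form in the toric ideal.
unique-concatMap : ∀ {A B : Set} (f : A → List B) (key : B → A) → (∀ x {z} → z ∈ f x → key z ≡ x) →
  (∀ x → Unique (f x)) → ∀ {xs} → Unique xs → Unique (concatMap f xs)
unique-concatMap f key keyed uf {[]}     []         = []
unique-concatMap f key keyed uf {x ∷ xs} (x∉ ∷ uxs) =
  Unique.++⁺ (uf x) (unique-concatMap f key keyed uf uxs) λ (z∈fx , z∈rest) →
    let y , y∈xs , z∈fy = find (∈-concatMap⁻ f {xs = xs} z∈rest)
    in All.lookup x∉ y∈xs (trans (sym (keyed x z∈fx)) (keyed y z∈fy))

allVecs-unique : ∀ N k → Unique (allVecs N k)
allVecs-unique N zero    = [] ∷ []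
allVecs-unique N (suc k) = unique-concatMap (λ x → map (x ∷_) (allVecs N k)) Vec.head keyed
  (λ x → Unique.map⁺ (proj₂ ∘ ∷-injective) (allVecs-unique N k)) (Unique.upTo⁺ (suc N))
  where
  keyed : ∀ x {z} → z ∈ map (x ∷_) (allVecs N k) → Vec.head z ≡ x
  keyed x p with ∈-map⁻ (x ∷_) p
  ... | _ , _ , refl = refl

rows : ℕ → Vec ℕ 3 → Vec ℕ 3 → List Mat
rows N a b = map (λ c → a ∷ b ∷ c ∷ []) (allVecs N 3)

allMats-unique : ∀ N → Unique (allMats N)
allMats-unique N = unique-concatMap (λ a → concatMap (λ b → rows N a b) (allVecs N 3)) Vec.head first-row
  (λ a → unique-concatMap (rows N a) (Vec.head ∘ Vec.tail) (second-row a)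
    (λ b → Unique.map⁺ (λ { refl → refl }) (allVecs-unique N 3)) (allVecs-unique N 3)) (allVecs-unique N 3)
  where
  second-row : ∀ a b {z} → z ∈ rows N a b → Vec.head (Vec.tail z) ≡ b
  second-row a b p with ∈-map⁻ (λ c → a ∷ b ∷ c ∷ []) p
  ... | _ , _ , refl = refl
  first-row : ∀ a {z} → z ∈ concatMap (λ b → rows N a b) (allVecs N 3) → Vec.head z ≡ a
  first-row a p with find (∈-concatMap⁻ (rows N a) {xs = allVecs N 3} p)
  ... | b , _ , q with ∈-map⁻ (λ c → a ∷ b ∷ c ∷ []) q
  ...   | _ , _ , refl = refl

∈-concatMap : ∀ {A B : Set} (f : A → List B) {x xs z} → x ∈ xs → z ∈ f x → z ∈ concatMap f xs
∈-concatMap f x∈xs z∈fx = ∈-concatMap⁺ f (lose x∈xs z∈fx)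

∈-allVecs : ∀ N {k} (v : Vec ℕ k) → (∀ i → lookup v i ≤ N) → v ∈ allVecs N k
∈-allVecs N []      _ = here refl
∈-allVecs N (x ∷ v) h = ∈-concatMap (λ x → map (x ∷_) (allVecs N _))
  (∈-upTo⁺ (s≤s (h zero))) (∈-map⁺ (x ∷_) (∈-allVecs N v (h ∘ suc)))

∈-allMats : ∀ N (M : Mat) → (∀ i j → lookup (lookup M i) j ≤ N) → M ∈ allMats N
∈-allMats N (a ∷ b ∷ c ∷ []) h = ∈-concatMap (λ a → concatMap (rows N a) (allVecs N 3))
  (∈-allVecs N a (h 0F)) (∈-concatMap (rows N a) (∈-allVecs N b (h 1F))
    (∈-map⁺ (λ c → a ∷ b ∷ c ∷ []) (∈-allVecs N c (h 2F))))

lookup-injective : ∀ {A : Set} {xs : List A} → Unique xs → ∀ i j →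
  List.lookup xs i ≡ List.lookup xs j → i ≡ j
lookup-injective (x∉ ∷ u) zero    zero    e = refl
lookup-injective (x∉ ∷ u) zero    (suc j) e = contradiction e (All.lookup x∉ (∈-lookup j))
lookup-injective (x∉ ∷ u) (suc i) zero    e = contradiction (sym e) (All.lookup x∉ (∈-lookup i))
lookup-injective (x∉ ∷ u) (suc i) (suc j) e = cong suc (lookup-injective u i j e)

entries : Mat → Table
entries M i j = lookup (lookup M i) j

vec-ext : ∀ {A : Set} {k} {u v : Vec A k} → (∀ i → lookup u i ≡ lookup v i) → u ≡ v
vec-ext {u = u} {v} h = trans (sym (tabulate∘lookup u)) (trans (tabulate-cong h) (tabulate∘lookup v))

entries-injective : ∀ {M N} → (∀ i j → entries M i j ≡ entries N i j) → M ≡ N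
entries-injective h = vec-ext λ i → vec-ext (h i)

lookup-rowSums : ∀ M i → lookup (rowSums M) i ≡ entries M i 0F + entries M i 1F + entries M i 2F
lookup-rowSums M i = trans (lookup-map i sum M) (sum₃ (lookup M i))
  where
  sum₃ : ∀ (v : Vec ℕ 3) → sum v ≡ lookup v 0F + lookup v 1F + lookup v 2F
  sum₃ (x ∷ y ∷ z ∷ []) = assoc x y z
    where
    assoc : ∀ x y z → x + (y + (z + 0)) ≡ x + y + z
    assoc = solve-∀

lookup-colSums : ∀ M j → lookup (colSums M) j ≡ entries M 0F j + entries M 1F j + entries M 2F j
lookup-colSums ((a ∷ b ∷ c ∷ []) ∷ (d ∷ e ∷ f ∷ []) ∷ (g ∷ h ∷ i ∷ []) ∷ []) = λ where
    0F → assoc a d g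
    1F → assoc b e h
    2F → assoc c f i
  where
  assoc : ∀ x y z → x + (y + (z + 0)) ≡ x + y + z
  assoc = solve-∀

module LatticePoints (r c : Vec ℕ 3) where

  private
    HasSums : Mat → Set
    HasSums M = rowSums M ≡ r × colSums M ≡ c

    hasSums? : ∀ M → Dec (HasSums M)
    hasSums? M = (≡-dec _≟_ (rowSums M) r) ×-dec (≡-dec _≟_ (colSums M) c)

  pt-sums : ∀ k → rowSums (pt r c k) ≡ r × colSums (pt r c k) ≡ c
  pt-sums k = proj₂ (∈-filter⁻ hasSums? {xs = allMats (sum r)} (∈-lookup k))

  pt-injective : ∀ {k k′} → pt r c k ≡ pt r c k′ → k ≡ k′
  pt-injective {k} {k′} = lookup-injective (Unique.filter⁺ hasSums? (allMats-unique (sum r))) k k′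

  lookup≤sum : ∀ {k} (v : Vec ℕ k) i → lookup v i ≤ sum v
  lookup≤sum (x ∷ v) zero    = m≤m+n x (sum v)
  lookup≤sum (x ∷ v) (suc i) = ≤-trans (lookup≤sum v i) (m≤n+m (sum v) x)

  pt-complete : ∀ M → rowSums M ≡ r → colSums M ≡ c → ∃ λ k → pt r c k ≡ M
  pt-complete M rs cs = Any.index M∈ , sym (lookup-index M∈)
    where
    bounded : ∀ i j → entries M i j ≤ sum r
    bounded i j = ≤-trans (lookup≤sum (lookup M i) j) (≤-trans (≤-reflexive (sym (lookup-map i sum M)))
      (≤-trans (≤-reflexive (cong (λ v → lookup v i) rs)) (lookup≤sum r i)))
    M∈ : M ∈ latticePoints r c
    M∈ = ∈-filter⁺ hasSums? (∈-allMats (sum r) M bounded) (rs , cs)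

  combine-entries : ∀ {k} (u : Vec ℕ k) (p : Fin k → Mat) i j →
    entries (Vec.foldr _ _+M_ 0M (Vec.zipWith _·M_ u (Vec.tabulate p))) i j ≡
    dot u (λ k → entries (p k) i j)
  combine-entries []      p i j = trans (cong (λ v → lookup v j) (lookup-replicate i (Vec.replicate 3 0)))
    (lookup-replicate j 0)
  combine-entries (x ∷ u) p i j = begin
    lookup (lookup (A +M B) i) j                       ≡⟨ cong (λ v → lookup v j) (lookup-zipWith _ i A B) ⟩
    lookup (Vec.zipWith _+_ (lookup A i) (lookup B i)) j ≡⟨ lookup-zipWith _+_ j (lookup A i) (lookup B i) ⟩
    entries A i j + entries B i j                      ≡⟨ cong₂ _+_ scaled (combine-entries u (p ∘ suc) i j) ⟩
    x * entries (p zero) i j + dot u (λ k → entries (p (suc k)) i j) ∎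
    where
    open ≡-Reasoning
    A B : Mat
    A = x ·M p zero
    B = Vec.foldr _ _+M_ 0M (Vec.zipWith _·M_ u (Vec.tabulate (p ∘ suc)))
    scaled : entries A i j ≡ x * entries (p zero) i j
    scaled = trans (cong (λ v → lookup v j) (lookup-map i _ (p zero))) (lookup-map j (x *_) (lookup (p zero) i))

-- Permuting rows and columns

-- The transposition of `a` and `2F`; as an involution it translates tables in both directions.
exchange : Fin 3 → Fin 3 → Fin 3
exchange 0F = triple 2F 1F 0F
exchange 1F = triple 0F 2F 1F
exchange 2F = triple 0F 1F 2F

exchange-involutive : ∀ a i → exchange a (exchange a i) ≡ i
exchange-involutive = from-yes (Fin.all? λ a → Fin.all? λ i → exchange a (exchange a i) Fin.≟ i)

exchange-2 : ∀ a → exchange a 2F ≡ a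
exchange-2 = from-yes (Fin.all? λ a → exchange a 2F Fin.≟ a)

exchange-sum : ∀ a (f : Fin 3 → ℕ) → f (exchange a 0F) + f (exchange a 1F) + f (exchange a 2F) ≡ f 0F + f 1F + f 2F
exchange-sum 0F f = reverse (f 2F) (f 1F) (f 0F)
  where
  reverse : ∀ x y z → x + y + z ≡ z + y + x
  reverse = solve-∀
exchange-sum 1F f = swap (f 0F) (f 2F) (f 1F)
  where
  swap : ∀ x y z → x + y + z ≡ x + z + y
  swap = solve-∀
exchange-sum 2F f = refl

module Reduction (r c′ : Vec ℕ 3) (a b : Fin 3) (r<c : lookup r a < lookup c′ b) where

  open LatticePoints r c′

  private
    n : ℕ
    n = nPts r c′

  -- Rows and columns are permuted so that the row and the column with r < c come last.
  P : Fin n → Table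
  P k i j = entries (pt r c′ k) (exchange a i) (exchange b j)

  R C : Fin 3 → ℕ
  R i = lookup r (exchange a i)
  C j = lookup c′ (exchange b j)

  R₂<C₂ : R 2F < C 2F
  R₂<C₂ = subst₂ (λ i j → lookup r i < lookup c′ j) (sym (exchange-2 a)) (sym (exchange-2 b)) r<c

  lattice-point : ∀ k → HasMargins R C (P k)
  lattice-point k = margins
    (λ i → trans (exchange-sum b (entries M (exchange a i))) (trans (sym (lookup-rowSums M (exchange a i)))
             (cong (λ v → lookup v (exchange a i)) (proj₁ (pt-sums k)))))
    (λ j → trans (exchange-sum a (λ i → entries M i (exchange b j))) (trans (sym (lookup-colSums M (exchange b j)))
             (cong (λ v → lookup v (exchange b j)) (proj₂ (pt-sums k)))))
    where
    M : Mat
    M = pt r c′ k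

  complete : ∀ m → HasMargins R C m → ∃ λ k → ∀ i j → P k i j ≡ m i j
  complete m (margins row col) = k , λ i j → trans (cong (λ M → entries M (exchange a i) (exchange b j)) pt≡M)
    (trans (M-entries (exchange a i) (exchange b j)) (cong₂ m (exchange-involutive a i) (exchange-involutive b j)))
    where
    permuted : Table
    permuted i j = m (exchange a i) (exchange b j)
    M : Mat
    M = Vec.tabulate (Vec.tabulate ∘ permuted)
    M-entries : ∀ i j → entries M i j ≡ permuted i j
    M-entries i j = trans (cong (λ v → lookup v j) (lookup∘tabulate (Vec.tabulate ∘ permuted) i)) (lookup∘tabulate (permuted i) j)
    sum₃ : ∀ {x y z x′ y′ z′ : ℕ} → x ≡ x′ → y ≡ y′ → z ≡ z′ → x + y + z ≡ x′ + y′ + z′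
    sum₃ refl refl refl = refl
    M-rows : rowSums M ≡ r
    M-rows = vec-ext λ i → trans (lookup-rowSums M i) (trans (sum₃ (M-entries i 0F) (M-entries i 1F) (M-entries i 2F))
      (trans (exchange-sum b (m (exchange a i))) (trans (row (exchange a i)) (cong (lookup r) (exchange-involutive a i)))))
    M-cols : colSums M ≡ c′
    M-cols = vec-ext λ j → trans (lookup-colSums M j) (trans (sum₃ (M-entries 0F j) (M-entries 1F j) (M-entries 2F j))
      (trans (exchange-sum a (λ i → m i (exchange b j))) (trans (col (exchange b j)) (cong (lookup c′) (exchange-involutive b j)))))
    k : Fin n
    k = proj₁ (pt-complete M M-rows M-cols)
    pt≡M : pt r c′ k ≡ M
    pt≡M = proj₂ (pt-complete M M-rows M-cols)

  P-injective : ∀ {k k′} → (∀ i j → P k i j ≡ P k′ i j) → k ≡ k′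
  P-injective {k} {k′} h = pt-injective (entries-injective λ i j →
    subst₂ (λ i j → entries (pt r c′ k) i j ≡ entries (pt r c′ k′) i j)
      (exchange-involutive a i) (exchange-involutive b j) (h (exchange a i) (exchange b j)))

  open Transportation P R C lattice-point complete P-injective R₂<C₂ public

  module _ {c ℓ : Level} (F : Field c ℓ) where

    open Poly F
    open Toric r c′ using (imgMono; φ; InToric)
    open InitialIdeal F imgMono
    open MonomialOrder (weight ∘ P) using (_≺_)

    imgMono⇒sameImage : ∀ {u v} → imgMono u ≡ imgMono v → SameImage u v
    imgMono⇒sameImage {u} {v} eq = cong proj₁ eq , λ i j →
      trans (sym (combine-entries u (pt r c′) (exchange a i) (exchange b j)))
        (trans (cong (λ e → entries (proj₂ e) (exchange a i) (exchange b j)) eq)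
          (combine-entries v (pt r c′) (exchange a i) (exchange b j)))

    sameImage⇒imgMono : ∀ {u v} → SameImage u v → imgMono u ≡ imgMono v
    sameImage⇒imgMono {u} {v} (p , q) = cong₂ _,_ p (entries-injective λ i j →
      trans (combine-entries u (pt r c′) i j) (trans (dots i j) (sym (combine-entries v (pt r c′) i j))))
      where
      dots : ∀ i j → dot u (λ k → entries (pt r c′ k) i j) ≡ dot v (λ k → entries (pt r c′ k) i j)
      dots i j = subst₂ (λ i j → dot u (λ k → entries (pt r c′ k) i j) ≡ dot v (λ k → entries (pt r c′ k) i j))
        (exchange-involutive a i) (exchange-involutive b j) (q (exchange a i) (exchange b j))

    φ-map : ∀ p → φ p ≡ map (map₂ imgMono) p
    φ-map []            = refl
    φ-map ((x , u) ∷ p) = cong ((x , imgMono u) ∷_) (φ-map p)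

    open Field F using (_≈_; 0#)

    sound : ∀ f → InToric f → ∀ e → imageCoeff f e ≈ 0#
    sound f f∈I e = subst (λ p → coeff _≟T_ p e ≈ 0#) (φ-map f) (f∈I e)

    kernel : ∀ f → (∀ e → imageCoeff f e ≈ 0#) → InToric f
    kernel f h e = subst (λ p → coeff _≟T_ p e ≈ 0#) (sym (φ-map f)) (h e)

    order : TermOrder n
    order = termOrder (weight ∘ P) InToric sound kernel

    squarefree : All SquarefreeQuadratic leadingTerms
    squarefree = All.tabulate λ g∈ → case leadingTerms-sound g∈ of λ where
      (a , b , refl , a≢b , _) → sum-pair a b , VAll.lookup⁻ (pair-squarefree a≢b)

    leading : ∀ {g} → g ∈ leadingTerms → ∃ λ h → h ≺ g × imgMono h ≡ imgMono g
    leading {g} g∈ = let _ , _ , _ , _ , h , h≺g , same = leadingTerms-sound g∈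
                     in h , h≺g , sym (sameImage⇒imgMono {g} {h} same)

    divisible-or-minimal : ∀ m → (∃ λ g → ∃ λ t → g ∈ leadingTerms × g ⊕ t ≡ m) ⊎
      (∀ v → imgMono v ≡ imgMono m → ¬ v ≺ m)
    divisible-or-minimal m = case divisible-or-standard m of λ where
      (inj₁ divisible) → inj₁ divisible
      (inj₂ standard)  → inj₂ λ v eq → standard-minimal standard v (imgMono⇒sameImage {m} {v} (sym eq))

    generated = initial-ideal (weight ∘ P) InToric sound kernel leadingTerms leading divisible-or-minimal

-- A row sum below a column sum, and the conclusion

squeeze : ∀ {a b c a′ b′ c′} → a′ ≤ a → b′ ≤ b → c′ ≤ c → a + b + c ≡ a′ + b′ + c′ →
  a ≡ a′ × b ≡ b′ × c ≡ c′
squeeze {a} {b} {c} {a′} {b′} {c′} p q s eq =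
  ≤-antisym (≮⇒≥ λ lt → <-irrefl (sym eq) (+-mono-<-≤ (+-mono-<-≤ lt q) s)) p ,
  ≤-antisym (≮⇒≥ λ lt → <-irrefl (sym eq) (+-mono-<-≤ (+-mono-≤-< p lt) s)) q ,
  ≤-antisym (≮⇒≥ λ lt → <-irrefl (sym eq) (+-mono-≤-< (+-mono-≤ p q) lt)) s

-- Otherwise every column sum is at most every row sum. As the totals agree, any matching of rows
-- with columns consists of equalities; the identity and a cyclic shift together link all six
-- numbers.
row<column : ∀ (r c : Vec ℕ 3) → VAll (1 ≤_) r → sum r ≡ sum c →
  ¬ (Σ ℕ λ k → 1 ≤ k × r ≡ k ∷ k ∷ k ∷ [] × c ≡ k ∷ k ∷ k ∷ []) →
  ∃ λ i → ∃ λ j → lookup r i < lookup c j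
row<column r@(r₀ ∷ r₁ ∷ r₂ ∷ []) c@(c₀ ∷ c₁ ∷ c₂ ∷ []) (pos ∷ _) eq not-multiple =
  case Fin.any? (λ i → Fin.any? λ j → lookup r i <? lookup c j) of λ where
    (yes w) → w
    (no ∄) →
      let c≤r : ∀ i j → lookup c j ≤ lookup r i
          c≤r i j = ≮⇒≥ λ lt → ∄ (i , j , lt)
          total : r₀ + r₁ + r₂ ≡ c₀ + c₁ + c₂
          total = trans (assoc r₀ r₁ r₂) (trans eq (sym (assoc c₀ c₁ c₂)))
          e₀ , e₁ , e₂ = squeeze (c≤r 0F 0F) (c≤r 1F 1F) (c≤r 2F 2F) total
          f₀ , f₁ , f₂ = squeeze (c≤r 0F 1F) (c≤r 1F 2F) (c≤r 2F 0F) (trans total (rotate c₀ c₁ c₂))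
          g₁ = trans e₁ (sym f₀)
          g₂ = trans f₂ (sym e₀)
      in contradiction
           (r₀ , pos , cong₂ (λ x y → r₀ ∷ x ∷ y ∷ []) g₁ g₂ ,
            trans (cong (λ x → x ∷ c₁ ∷ c₂ ∷ []) (sym e₀))
              (cong₂ (λ x y → r₀ ∷ x ∷ y ∷ []) (sym f₀) (trans (sym e₂) g₂)))
           not-multiple
  where
  assoc : ∀ x y z → x + y + z ≡ x + (y + (z + 0))
  assoc = solve-∀
  rotate : ∀ x y z → x + y + z ≡ y + z + x
  rotate = solve-∀

theorem1p3 : ∀ {c ℓ : Level} (F : Field c ℓ) (r c′ : Vec ℕ 3) →
    VAll (1 ≤_) r → VAll (1 ≤_) c′ → sum r ≡ sum c′ →
    ¬ (Σ ℕ λ k → 1 ≤ k × r ≡ k ∷ k ∷ k ∷ [] × c′ ≡ k ∷ k ∷ k ∷ []) →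
    let open Poly F
        open Toric r c′
    in Σ (TermOrder n) λ T → Σ (List (Mono n)) λ G →
         All SquarefreeQuadratic G ×
         (∀ (p : Pol n) →
            ((p ∈⟨ InitGen T InToric ⟩) → (p ∈⟨ (λ g → Σ (Mono n) λ m → m ∈ G × g ≡ monoP m) ⟩)) ×
            ((p ∈⟨ (λ g → Σ (Mono n) λ m → m ∈ G × g ≡ monoP m) ⟩) → (p ∈⟨ InitGen T InToric ⟩)))
theorem1p3 F r c′ r-pos c-pos eq not-multiple =
  let i , j , r<c = row<column r c′ r-pos eq not-multiple
      open Reduction r c′ i j r<c
  in order F , leadingTerms , squarefree F , generated F
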